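{- For every $\alpha,d \in (0,1]$ there exist an integer $n_0$ and a real $\rho>0$ such that the following holds for all $n \geq n_0$. Let $H$ be an $n$-vertex $(\rho,d)$-cherry-dense $3$-graph satisfying $\delta_1(H) \geq \alpha \binom n2$. Then $H$ has a tight Hamilton cycle.
   Context: A $3$-graph $H$ has vertex set $V(H)$ and edge set $E(H)$ consisting of $3$-element subsets of $V(H)$. For a vertex $v$, $\deg_H(v)$ is the number of edges containing $v$, and $\delta_1(H)=\min_{v\in V(H)}\deg_H(v)$. For $\vec G_1,\vec G_2 \subseteq V(H)\times V(H)$ let $\mathcal{P}_2(\vec G_1,\vec G_2)=\{(x,y,z)\in V(H)^3: (x,y)\in \vec G_1, (y,z)\in \vec G_2\}$ and $e_H(\vec G_1,\vec G_2)=|\{(x,y,z)\in \mathcal{P}_2(\vec G_1,\vec G_2): \{x,y,z\}\in E(H)\}|$. An $n$-vertex $3$-graph $H$ is $(\rho,d)$-cherry-dense if $e_H(\vec G_1,\vec G_2)\ge d|\mathcal{P}_2(\vec G_1,\vec G_2)|-\rho n^3$ for every $\vec G_1,\vec G_2\subseteq V(H)\times V(H)$. A tight cycle is a $3$-graph whose vertices can be ordered cyclically so that every $3$ consecutive vertices form an edge; a tight Hamilton cycle of $H$ is a tight cycle that is a spanning subgraph of $H$ (contains all vertices of $H$). -}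

module Defs where

open import Data.Bool using (Bool; true; false; if_then_else_; _∧_)
open import Data.Nat as ℕ using (ℕ; zero; suc; _<ᵇ_)
open import Data.Nat.DivMod using (_%_; m%n<n)
open import Data.Nat.Combinatorics using (_C_)
open import Data.Fin using (Fin; toℕ; fromℕ<)
open import Data.List using (List; map; allFin)
open import Data.Nat.ListAction using (sum)
open import Data.Integer using (+_)
open import Data.Rational using (ℚ; _/_; _*_; _-_; _≤_)
open import Data.Product using (Σ; _×_)
open import Relation.Binary.PropositionalEquality using (_≡_; _≢_)
open import Function.Definitions using (Bijective)

-- A 3-graph on vertex set Fin n.  Edges are 3-element subsets {x,y,z};
-- they are encoded by a Boolean predicate on ordered triples that is
-- invariant under permutation and true only on triples of distinct vertices.
record 3Graph (n : ℕ) : Set where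
  field
    edge   : Fin n → Fin n → Fin n → Bool
    sym₁₂  : ∀ x y z → edge x y z ≡ edge y x z
    sym₂₃  : ∀ x y z → edge x y z ≡ edge x z y
    dist₁₂ : ∀ x y z → edge x y z ≡ true → x ≢ y
    dist₂₃ : ∀ x y z → edge x y z ≡ true → y ≢ z
    dist₁₃ : ∀ x y z → edge x y z ≡ true → x ≢ z
open 3Graph public

ΣV : (n : ℕ) → (Fin n → ℕ) → ℕ
ΣV n f = sum (map f (allFin n))

𝟙 : Bool → ℕ
𝟙 b = if b then 1 else 0

ℕtoℚ : ℕ → ℚ
ℕtoℚ k = (+ k) / 1

-- deg_H(v): number of edges {v,x,y} containing v (counted once via x < y)
deg : ∀ {n} → 3Graph n → Fin n → ℕ
deg {n} H v = ΣV n λ x → ΣV n λ y → 𝟙 ((toℕ x <ᵇ toℕ y) ∧ edge H v x y)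

minDegAtLeast : ∀ {n} → 3Graph n → ℚ → Set
minDegAtLeast {n} H α = ∀ v → α * ℕtoℚ (n C 2) ≤ ℕtoℚ (deg H v)

DiGraph : ℕ → Set
DiGraph n = Fin n → Fin n → Bool

|P₂| : ∀ {n} → DiGraph n → DiGraph n → ℕ
|P₂| {n} G₁ G₂ = ΣV n λ x → ΣV n λ y → ΣV n λ z → 𝟙 (G₁ x y ∧ G₂ y z)

eH : ∀ {n} → 3Graph n → DiGraph n → DiGraph n → ℕ
eH {n} H G₁ G₂ =
  ΣV n λ x → ΣV n λ y → ΣV n λ z → 𝟙 (G₁ x y ∧ G₂ y z ∧ edge H x y z)

CherryDense : ∀ {n} → 3Graph n → ℚ → ℚ → Set
CherryDense {n} H ρ d = ∀ (G₁ G₂ : DiGraph n) →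
  d * ℕtoℚ (|P₂| G₁ G₂) - ρ * ℕtoℚ (n ℕ.^ 3) ≤ ℕtoℚ (eH H G₁ G₂)

csuc : ∀ {n} → Fin n → Fin n
csuc {suc m} i = fromℕ< (m%n<n (suc (toℕ i)) (suc m))

HasTightHamCycle : ∀ {n} → 3Graph n → Set
HasTightHamCycle {n} H = Σ (Fin n → Fin n) λ σ →
  Bijective _≡_ _≡_ σ ×
  (∀ i → edge H (σ i) (σ (csuc i)) (σ (csuc (csuc i))) ≡ true)

{-# OPTIONS --safe #-}
module Submission where

-- Cherry density with density d ≥ 1/D forces all but few vertices b to be good: between any two
-- sets the link graph of b has density at least 1/D up to a small error.  If b is good and
-- X, Z are linear-sized, then for almost every x ∈ X the pair bx forms edges with |Z|/2D vertices of Z,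
-- so a tight path ending in a good vertex can be prolonged one vertex at a time, steering into any
-- prescribed linear-sized sets, and two ends at good vertices can be joined through three vertices.
--
-- The cycle is built as follows.  Grow a path in stretches of four vertices a b c d, each chosen so
-- that a constant fraction of the vertices v not yet saturated has abv, bcv, cdv ∈ E(H); such a v can
-- later be inserted between b and c.  Since total deficiency drops linearly with every stretch,
-- few stretches leave only few unsaturated vertices.  These and the bad vertices are then put on the
-- path one by one, inside f v g h with fg, gh in the link of v; this is the only use of the
-- minimum degree.  Set aside a small reservoir in the common neighbourhood of the first two vertices,
-- prolong the path greedily until equally few other vertices remain, close it through the reservoir,
-- and insert the leftover vertices into distinct stretches.

open import Defs
open import Data.Bool using (Bool; true; false; T; _∧_; _∨_; not)
open import Data.Bool.Properties using (∧-zeroʳ; ∧-identityʳ)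
open import Data.Nat using (ℕ; zero; suc; pred; _+_; _*_; _∸_; _^_; _≤_; _<_; _≥_; z≤n; s≤s; s≤s⁻¹; _≤?_; _<ᵇ_; _≡ᵇ_; _≟_; NonZero; >-nonZero; >-nonZero⁻¹)
open import Data.Nat.Properties hiding (_≤?_; _≟_)
open import Data.Nat.DivMod using (_/_; _%_; m/n*n≤m; m≡m%n+[m/n]*n; m%n<n; m≥n⇒m/n>0; m<n⇒m%n≡m; n%n≡0)
open import Data.Nat.ListAction using (sum)
open import Data.Nat.Tactic.RingSolver using (solve-∀)
open import Data.Fin using (Fin; zero; suc; toℕ; fromℕ<)
import Data.Fin.Properties as Fin
open import Data.Fin.Subset using (Subset)
open import Data.Fin.Subset.Properties using (anySubset?)
import Data.Vec as Vec
open import Data.Vec.Properties using (lookup∘tabulate)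
open import Data.List using (List; []; _∷_; _++_; map; allFin; length; tabulate)
open import Data.List.Properties using (map-tabulate; length-++; length-tabulate)
open import Data.Product using (Σ; ∃; _×_; _,_; proj₁; proj₂)
open import Data.Sum using (_⊎_; inj₁; inj₂)
open import Data.Unit using (⊤; tt)
open import Relation.Nullary using (¬_; Dec; yes; no; does; contradiction)
open import Relation.Binary.PropositionalEquality using (_≡_; _≢_; refl; sym; trans; cong; cong₂; subst; subst₂)
open import Function using (_∘_; id; it)


-- Finite sums and vertex sets

-- A linear inequality follows from the combination L ≤ R of its hypotheses by a semiring identity.
lin : ∀ {L R a b} slack → L ≤ R → a + R + slack ≡ b + L → a ≤ b
lin {L} {R} {a} {b} slack L≤R eq = +-cancelʳ-≤ L a b (begin
  a + L         ≤⟨ +-monoʳ-≤ a L≤R ⟩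
  a + R         ≤⟨ m≤m+n (a + R) slack ⟩
  a + R + slack ≡⟨ eq ⟩
  b + L         ∎)
  where open ≤-Reasoning

sum-mono : ∀ {A : Set} {f g : A → ℕ} (xs : List A) → (∀ x → f x ≤ g x) → sum (map f xs) ≤ sum (map g xs)
sum-mono []       f≤g = z≤n
sum-mono (x ∷ xs) f≤g = +-mono-≤ (f≤g x) (sum-mono xs f≤g)

sum-+ : ∀ {A : Set} (f g : A → ℕ) (xs : List A) → sum (map (λ x → f x + g x) xs) ≡ sum (map f xs) + sum (map g xs)
sum-+ f g []       = refl
sum-+ f g (x ∷ xs) = trans (cong (f x + g x +_) (sum-+ f g xs)) (interchange (f x) (g x) _ _)
  where
  interchange : ∀ a b c d → a + b + (c + d) ≡ a + c + (b + d)
  interchange = solve-∀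

sum-*ˡ : ∀ {A : Set} c (f : A → ℕ) (xs : List A) → sum (map (λ x → c * f x) xs) ≡ c * sum (map f xs)
sum-*ˡ c f []       = sym (*-zeroʳ c)
sum-*ˡ c f (x ∷ xs) = trans (cong (c * f x +_) (sum-*ˡ c f xs)) (sym (*-distribˡ-+ c (f x) _))

sum-const : ∀ {A : Set} c (xs : List A) → sum (map (λ _ → c) xs) ≡ length xs * c
sum-const c []       = refl
sum-const c (x ∷ xs) = cong (c +_) (sum-const c xs)

sum-swap : ∀ {A B : Set} (f : A → B → ℕ) (xs : List A) (ys : List B) →
  sum (map (λ x → sum (map (f x) ys)) xs) ≡ sum (map (λ y → sum (map (λ x → f x y) xs)) ys)
sum-swap f []       ys = sym (trans (sum-const 0 ys) (*-zeroʳ (length ys)))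
sum-swap f (x ∷ xs) ys = trans (cong (sum (map (f x) ys) +_) (sum-swap f xs ys)) (sym (sum-+ (f x) _ ys))

sum-find : ∀ {A : Set} (f g : A → ℕ) (xs : List A) → sum (map f xs) < sum (map g xs) → ∃ λ x → f x < g x
sum-find f g (x ∷ xs) lt with suc (f x) ≤? g x
... | yes p = x , p
... | no ¬p = sum-find f g xs (≰⇒> λ q → <⇒≱ lt (+-mono-≤ (≮⇒≥ ¬p) q))

-- Kept opaque so that unification can recover the summand.
opaque
  Σᵥ : ∀ {n} → (Fin n → ℕ) → ℕ
  Σᵥ {n} f = ΣV n f

module _ {n : ℕ} where
  opaque
    unfolding Σᵥ

    ΣV≡Σᵥ : (f : Fin n → ℕ) → ΣV n f ≡ Σᵥ f
    ΣV≡Σᵥ f = refl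

    Σ-mono : {f g : Fin n → ℕ} → (∀ x → f x ≤ g x) → Σᵥ f ≤ Σᵥ g
    Σ-mono = sum-mono (allFin n)

    Σ-+ : (f g : Fin n → ℕ) → Σᵥ (λ x → f x + g x) ≡ Σᵥ f + Σᵥ g
    Σ-+ f g = sum-+ f g (allFin n)

    Σ-*ˡ : ∀ c (f : Fin n → ℕ) → Σᵥ (λ x → c * f x) ≡ c * Σᵥ f
    Σ-*ˡ c f = sum-*ˡ c f (allFin n)

    Σ-const : ∀ c → Σᵥ (λ (_ : Fin n) → c) ≡ n * c
    Σ-const c = trans (sum-const c (allFin n)) (cong (_* c) (length-tabulate {n = n} id))

    Σ-swap : (f : Fin n → Fin n → ℕ) → Σᵥ (λ x → Σᵥ (f x)) ≡ Σᵥ (λ y → Σᵥ λ x → f x y)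
    Σ-swap f = sum-swap f (allFin n) (allFin n)

    Σ-find : (f g : Fin n → ℕ) → Σᵥ f < Σᵥ g → ∃ λ x → f x < g x
    Σ-find f g = sum-find f g (allFin n)

opaque
  unfolding Σᵥ

  Σ-suc : ∀ n (f : Fin (suc n) → ℕ) → Σᵥ f ≡ f zero + Σᵥ (f ∘ suc)
  Σ-suc n f = cong (f zero +_) (cong sum (trans (map-tabulate suc f) (sym (map-tabulate id (f ∘ suc)))))

module _ {n : ℕ} where

  Σ-cong : {f g : Fin n → ℕ} → (∀ x → f x ≡ g x) → Σᵥ f ≡ Σᵥ g
  Σ-cong eq = ≤-antisym (Σ-mono (≤-reflexive ∘ eq)) (Σ-mono (≤-reflexive ∘ sym ∘ eq))

  Σ-*ʳ : ∀ c (f : Fin n → ℕ) → Σᵥ (λ x → f x * c) ≡ Σᵥ f * c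
  Σ-*ʳ c f = trans (Σ-cong λ x → *-comm (f x) c) (trans (Σ-*ˡ c f) (*-comm c _))

  Σ-zero : Σᵥ (λ (_ : Fin n) → 0) ≡ 0
  Σ-zero = trans (Σ-const 0) (*-zeroʳ n)

  Σ-one : Σᵥ (λ (_ : Fin n) → 1) ≡ n
  Σ-one = trans (Σ-const 1) (*-identityʳ n)

  Σ-pos : (f : Fin n → ℕ) → 0 < Σᵥ f → ∃ λ x → 0 < f x
  Σ-pos f 0<Σ = Σ-find (λ _ → 0) f (subst (_< Σᵥ f) (sym Σ-zero) 0<Σ)

infix 4 _==_
_==_ : ∀ {n} → Fin n → Fin n → Bool
x == y = does (x Fin.≟ y)

==-refl : ∀ {n} (x : Fin n) → (x == x) ≡ true
==-refl x with x Fin.≟ x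
... | yes _ = refl
... | no ¬p = contradiction refl ¬p

==-≢ : ∀ {n} {x y : Fin n} → x ≢ y → (x == y) ≡ false
==-≢ {x = x} {y} x≢y with x Fin.≟ y
... | yes p = contradiction p x≢y
... | no  _ = refl

Σ-point : ∀ {n} (x : Fin n) → Σᵥ (λ v → 𝟙 (v == x)) ≡ 1
Σ-point {suc n} zero    = trans (Σ-suc n (λ v → 𝟙 (v == zero))) (cong suc (Σ-zero {n}))
Σ-point {suc n} (suc x) = trans (Σ-suc n (λ v → 𝟙 (v == suc x))) (Σ-point x)

∧-true : ∀ {a b} → a ∧ b ≡ true → a ≡ true × b ≡ true
∧-true {true} {true} refl = refl , refl

∧-intro : ∀ {a b} → a ≡ true → b ≡ true → a ∧ b ≡ true
∧-intro refl refl = refl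

not-true : ∀ {a} → not a ≡ true → a ≡ false
not-true {false} _ = refl

𝟙-pos : ∀ {b} → 0 < 𝟙 b → b ≡ true
𝟙-pos {true} _ = refl

𝟙-≤ : ∀ {b m} → (b ≡ true → 1 ≤ m) → 𝟙 b ≤ m
𝟙-≤ {true}  h = h refl
𝟙-≤ {false} h = z≤n

𝟙-∧ : ∀ a b → 𝟙 (a ∧ b) ≡ 𝟙 a * 𝟙 b
𝟙-∧ true  b = sym (+-identityʳ (𝟙 b))
𝟙-∧ false b = refl

-- Vertex sets and their sizes

VSet : ℕ → Set
VSet n = Fin n → Bool

⟪_⟫ : ∀ {n} → VSet n → ℕ
⟪ X ⟫ = Σᵥ λ v → 𝟙 (X v)

_∖_ : ∀ {n} → VSet n → Fin n → VSet n
(X ∖ x) v = X v ∧ not (v == x)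

module _ {n : ℕ} where

  card-mono : (X Y : VSet n) → (∀ v → X v ≡ true → Y v ≡ true) → ⟪ X ⟫ ≤ ⟪ Y ⟫
  card-mono X Y h = Σ-mono λ v → 𝟙-≤ {X v} λ p → ≤-reflexive (cong 𝟙 (sym (h v p)))

  card-witness : (X : VSet n) → 0 < ⟪ X ⟫ → ∃ λ v → X v ≡ true
  card-witness X 0<X with Σ-pos (𝟙 ∘ X) 0<X
  ... | v , p = v , 𝟙-pos p

  card-empty : (X : VSet n) → ⟪ X ⟫ ≡ 0 → ∀ v → X v ≡ false
  card-empty X X≡0 v with X v in eq
  ... | false = refl
  ... | true  = contradiction (≤-trans pos (≤-reflexive X≡0)) λ ()
    where
    pos : 1 ≤ ⟪ X ⟫
    pos = subst (_≤ ⟪ X ⟫) (Σ-point v) (card-mono (_== v) X sub)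
      where
      sub : ∀ u → (u == v) ≡ true → X u ≡ true
      sub u p with u Fin.≟ v
      ... | yes refl = eq

  card-∖ : (X : VSet n) (x : Fin n) → X x ≡ true → suc ⟪ X ∖ x ⟫ ≡ ⟪ X ⟫
  card-∖ X x Xx = trans (+-comm 1 _) (trans (cong (⟪ X ∖ x ⟫ +_) (sym (Σ-point x)))
    (trans (sym (Σ-+ _ _)) (Σ-cong pt)))
    where
    pt : ∀ v → 𝟙 ((X ∖ x) v) + 𝟙 (v == x) ≡ 𝟙 (X v)
    pt v with v Fin.≟ x
    ... | yes refl rewrite Xx = refl
    ... | no  _ with X v
    ...   | true  = refl
    ...   | false = refl

  card-cover : (X Y Z : VSet n) → (∀ v → X v ≡ true → Y v ≡ true ⊎ Z v ≡ true) → ⟪ X ⟫ ≤ ⟪ Y ⟫ + ⟪ Z ⟫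
  card-cover X Y Z h = ≤-trans (Σ-mono λ v → 𝟙-≤ {X v} λ p → pt v (h v p)) (≤-reflexive (Σ-+ _ _))
    where
    pt : ∀ v → Y v ≡ true ⊎ Z v ≡ true → 1 ≤ 𝟙 (Y v) + 𝟙 (Z v)
    pt v (inj₁ p) rewrite p = s≤s z≤n
    pt v (inj₂ p) rewrite p = m≤n+m 1 _

  subset-of-size : ∀ m r (X : VSet n) → ⟪ X ⟫ ≡ m + r → Σ (VSet n) λ Y → (∀ v → Y v ≡ true → X v ≡ true) × ⟪ Y ⟫ ≡ r
  subset-of-size zero    r X eq = X , (λ _ p → p) , eq
  subset-of-size (suc m) r X eq with card-witness X (subst (0 <_) (sym eq) (s≤s z≤n))
  ... | x , Xx with subset-of-size m r (X ∖ x) (suc-injective (trans (card-∖ X x Xx) eq))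
  ...   | Y , Y⊆ , cardY = Y , (λ v p → proj₁ (∧-true (Y⊆ v p))) , cardY

-- Multiplicities express at once that a vertex is off the path (0), that the path is simple (at
-- most 1) and that a cycle is spanning (always 1), and they sum to the length.
occ : ∀ {n} → Fin n → List (Fin n) → ℕ
occ v []      = 0
occ v (x ∷ L) = 𝟙 (v == x) + occ v L

module _ {n : ℕ} where

  occ-++ : ∀ (v : Fin n) xs L → occ v (xs ++ L) ≡ occ v xs + occ v L
  occ-++ v []       L = refl
  occ-++ v (x ∷ xs) L = trans (cong (𝟙 (v == x) +_) (occ-++ v xs L)) (sym (+-assoc (𝟙 (v == x)) _ _))

  Σ-occ : ∀ (L : List (Fin n)) → Σᵥ (λ v → occ v L) ≡ length L
  Σ-occ []      = Σ-zero
  Σ-occ (x ∷ L) = trans (Σ-+ _ _) (cong₂ _+_ (Σ-point x) (Σ-occ L))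

  fresh-∷ : ∀ {v x : Fin n} {L} → v ≢ x → occ v L ≡ 0 → occ v (x ∷ L) ≡ 0
  fresh-∷ v≢x v∉L rewrite ==-≢ v≢x = v∉L

  fresh-head : ∀ (v x : Fin n) L → occ v (x ∷ L) ≡ 0 → v ≢ x
  fresh-head v x L eq refl rewrite ==-refl v = contradiction eq λ ()

  fresh-drop : ∀ (v : Fin n) xs L → occ v (xs ++ L) ≡ 0 → occ v L ≡ 0
  fresh-drop v xs L eq = m+n≡0⇒n≡0 (occ v xs) (trans (sym (occ-++ v xs L)) eq)

  -- `F` is what the current phase forbids: the bad vertices while gadgets are built, the bad or
  -- unsaturated ones during insertion, the reservoir in the greedy phase.
  avail : VSet n → List (Fin n) → VSet n
  avail F L v = not (F v) ∧ (occ v L ≡ᵇ 0)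

  avail-elim : ∀ F L v → avail F L v ≡ true → F v ≡ false × occ v L ≡ 0
  avail-elim F L v p with ∧-true p
  ... | q , q′ = not-true q , z≡ (occ v L) q′
    where
    z≡ : ∀ m → (m ≡ᵇ 0) ≡ true → m ≡ 0
    z≡ zero _ = refl

  avail-intro : ∀ F L v → F v ≡ false → occ v L ≡ 0 → avail F L v ≡ true
  avail-intro F L v p q rewrite p | q = refl

  avail-dichotomy : ∀ F L v → 1 ≤ 𝟙 (avail F L v) + (𝟙 (F v) + occ v L)
  avail-dichotomy F L v with F v | occ v L
  ... | true  | _     = s≤s z≤n
  ... | false | zero  = s≤s z≤n
  ... | false | suc m = s≤s z≤n

  card-avail : ∀ F L (X Y : VSet n) → (∀ v → X v ≡ true → avail F L v ≡ true → Y v ≡ true) →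
    ⟪ X ⟫ ≤ ⟪ Y ⟫ + (⟪ F ⟫ + length L)
  card-avail F L X Y h = ≤-trans (Σ-mono pt) (≤-reflexive
    (trans (Σ-+ _ _) (cong (⟪ Y ⟫ +_) (trans (Σ-+ _ _) (cong (⟪ F ⟫ +_) (Σ-occ L))))))
    where
    pt : ∀ v → 𝟙 (X v) ≤ 𝟙 (Y v) + (𝟙 (F v) + occ v L)
    pt v = 𝟙-≤ {X v} λ p → ≤-trans (avail-dichotomy F L v)
      (+-monoˡ-≤ (𝟙 (F v) + occ v L) (𝟙-≤ {avail F L v} λ q → ≤-reflexive (cong 𝟙 (sym (h v p q)))))

  card-avail-≥ : ∀ F L → n ≤ ⟪ avail F L ⟫ + (⟪ F ⟫ + length L)
  card-avail-≥ F L = ≤-trans (≤-reflexive (sym Σ-one)) (card-avail F L (λ _ → true) (avail F L) (λ _ _ p → p))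

  card-without : ∀ xs (X Y : VSet n) →
    (∀ v → X v ≡ true → occ v xs ≡ 0 → Y v ≡ true) → ⟪ X ⟫ ≤ ⟪ Y ⟫ + length xs
  card-without xs X Y h = ≤-trans (Σ-mono pt) (≤-reflexive (trans (Σ-+ _ _) (cong (⟪ Y ⟫ +_) (Σ-occ xs))))
    where
    pt : ∀ v → 𝟙 (X v) ≤ 𝟙 (Y v) + occ v xs
    pt v with occ v xs in eq
    ... | suc m = ≤-trans (𝟙-≤ {X v} λ _ → s≤s z≤n) (m≤n+m (suc m) (𝟙 (Y v)))
    ... | zero  = ≤-trans (𝟙-≤ {X v} λ p → ≤-reflexive (cong 𝟙 (sym (h v p eq)))) (m≤m+n _ 0)

<ᵇ-true : ∀ m n → (m <ᵇ n) ≡ true → m < n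
<ᵇ-true m n p = <ᵇ⇒< m n (subst T (sym p) _)

<ᵇ-false : ∀ m n → (m <ᵇ n) ≡ false → n ≤ m
<ᵇ-false m n p = ≮⇒≥ λ lt → subst T p (<⇒<ᵇ lt)

-- Bi-dense links

module Link {n : ℕ} (H : 3Graph n) where

  E : Fin n → Fin n → Fin n → Set
  E x y z = edge H x y z ≡ true

  E₁₂ : ∀ {x y z} → E x y z → E y x z
  E₁₂ {x} {y} {z} = trans (sym (sym₁₂ H x y z))

  E₂₃ : ∀ {x y z} → E x y z → E x z y
  E₂₃ {x} {y} {z} = trans (sym (sym₂₃ H x y z))

  -- Ordered pairs are counted, so every edge at `v` contributes 2; the comparison with `deg` is
  -- `deg≤degree`.
  degree : Fin n → ℕ
  degree v = Σᵥ λ x → Σᵥ λ y → 𝟙 (edge H v x y)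

  N : Fin n → Fin n → VSet n → VSet n
  N a b Z z = Z z ∧ edge H a b z

  N-elim : ∀ a b Z {z} → N a b Z z ≡ true → Z z ≡ true × E a b z
  N-elim a b Z = ∧-true

  N-intro : ∀ {a b} (Z : VSet n) {z} → Z z ≡ true → E a b z → N a b Z z ≡ true
  N-intro Z = ∧-intro

  -- The number of pairs in `X` × `Z` that are adjacent in the link graph of `b`.
  e : Fin n → VSet n → VSet n → ℕ
  e b X Z = Σᵥ λ x → 𝟙 (X x) * ⟪ N b x Z ⟫

  e-cong : ∀ b {X X′ Z Z′ : VSet n} → (∀ v → X v ≡ X′ v) → (∀ v → Z v ≡ Z′ v) → e b X Z ≡ e b X′ Z′
  e-cong b X≗ Z≗ = Σ-cong λ x → cong₂ _*_ (cong 𝟙 (X≗ x)) (Σ-cong λ z → cong (λ q → 𝟙 (q ∧ edge H b x z)) (Z≗ z))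

  -- The link graph of b has density at least 1/D between any two sets, up to an error n²/K.
  Good : ℕ → ℕ → Fin n → Set
  Good D K b = ∀ X Z → K * (⟪ X ⟫ * ⟪ Z ⟫) ≤ K * D * e b X Z + n * n

  module FewBad (D K M : ℕ) .{{_ : NonZero D}}
    (cherry : ∀ G₁ G₂ → K * D * M * |P₂| G₁ G₂ ≤ D * (K * D * M) * eH H G₁ G₂ + D * n ^ 3) where

    -- The two sets range over the finite type `Subset n`, so that the existence of a violating pair
    -- is decidable and being bad is a Boolean predicate.
    Violates : Fin n → Subset n → Subset n → Set
    Violates b X Z = n * n + K * D * e b (Vec.lookup X) (Vec.lookup Z) < K * (⟪ Vec.lookup X ⟫ * ⟪ Vec.lookup Z ⟫)

    violated? : ∀ b → Dec (∃ λ X → ∃ λ Z → Violates b X Z)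
    violated? b = anySubset? λ X → anySubset? λ Z → suc (n * n + K * D * e b (Vec.lookup X) (Vec.lookup Z)) ≤? _

    bad : VSet n
    bad b = does (violated? b)

    bad-false⇒Good : ∀ b → bad b ≡ false → Good D K b
    bad-false⇒Good b eq X Z with violated? b
    ... | no ¬v = ≮⇒≥ λ lt → ¬v (Vec.tabulate X , Vec.tabulate Z , subst₂ _<_ l r lt)
      where
      X≗ : ∀ v → X v ≡ Vec.lookup (Vec.tabulate X) v
      X≗ v = sym (lookup∘tabulate X v)
      Z≗ : ∀ v → Z v ≡ Vec.lookup (Vec.tabulate Z) v
      Z≗ v = sym (lookup∘tabulate Z v)
      l : K * D * e b X Z + n * n ≡ n * n + K * D * e b (Vec.lookup (Vec.tabulate X)) (Vec.lookup (Vec.tabulate Z))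
      l = trans (+-comm _ (n * n)) (cong (λ q → n * n + K * D * q) (e-cong b X≗ Z≗))
      r : K * (⟪ X ⟫ * ⟪ Z ⟫) ≡ K * (⟪ Vec.lookup (Vec.tabulate X) ⟫ * ⟪ Vec.lookup (Vec.tabulate Z) ⟫)
      r = cong (K *_) (cong₂ _*_ (Σ-cong λ v → cong 𝟙 (X≗ v)) (Σ-cong λ v → cong 𝟙 (Z≗ v)))

    -- A bad vertex receives one pair of sets violating goodness, every other vertex two empty sets.
    -- The digraphs `G₁`, `G₂` below then have cherries centred at bad vertices only.
    left right : Fin n → VSet n
    left b with violated? b
    ... | yes (X , Z , _) = Vec.lookup X
    ... | no _            = λ _ → false
    right b with violated? b
    ... | yes (X , Z , _) = Vec.lookup Z
    ... | no _            = λ _ → false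

    deficit : ∀ b → 𝟙 (bad b) * (n * n) + K * D * e b (left b) (right b) ≤ K * (⟪ left b ⟫ * ⟪ right b ⟫)
    deficit b with violated? b
    ... | yes (X , Z , v) = ≤-trans (+-monoˡ-≤ _ (≤-reflexive (*-identityˡ (n * n)))) (<⇒≤ v)
    ... | no _            = ≤-trans (≤-reflexive (trans (cong (K * D *_) (Σ-zero {n})) (*-zeroʳ (K * D)))) z≤n

    G₁ G₂ : DiGraph n
    G₁ x b = left b x
    G₂ b z = right b z

    -- Cherries are grouped by their middle vertex `b`; those centred at `b` form the product of its
    -- two sets.
    P₂-links : |P₂| G₁ G₂ ≡ Σᵥ λ b → ⟪ left b ⟫ * ⟪ right b ⟫
    P₂-links = trans (trans (ΣV≡Σᵥ _) (Σ-cong λ x → trans (ΣV≡Σᵥ _) (Σ-cong λ b → ΣV≡Σᵥ _)))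
      (trans (Σ-swap _) (Σ-cong λ b → trans
        (Σ-cong λ x → trans (Σ-cong λ z → 𝟙-∧ (left b x) (right b z)) (Σ-*ˡ (𝟙 (left b x)) _))
        (Σ-*ʳ ⟪ right b ⟫ _)))

    eH-links : eH H G₁ G₂ ≡ Σᵥ λ b → e b (left b) (right b)
    eH-links = trans (trans (ΣV≡Σᵥ _) (Σ-cong λ x → trans (ΣV≡Σᵥ _) (Σ-cong λ b → ΣV≡Σᵥ _)))
      (trans (Σ-swap _) (Σ-cong λ b → Σ-cong λ x → trans
        (Σ-cong λ z → trans (𝟙-∧ (left b x) _)
          (cong (λ q → 𝟙 (left b x) * 𝟙 (right b z ∧ q)) (sym₁₂ H x b z)))
        (Σ-*ˡ (𝟙 (left b x)) _)))

    deficit-sum : n * n * ⟪ bad ⟫ + K * D * eH H G₁ G₂ ≤ K * |P₂| G₁ G₂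
    deficit-sum = begin
      n * n * ⟪ bad ⟫ + K * D * eH H G₁ G₂
        ≡⟨ cong₂ _+_ (*-comm (n * n) ⟪ bad ⟫) (cong (K * D *_) eH-links) ⟩
      ⟪ bad ⟫ * (n * n) + K * D * Σᵥ (λ b → e b (left b) (right b))
        ≡⟨ cong₂ _+_ (sym (Σ-*ʳ (n * n) _)) (sym (Σ-*ˡ (K * D) _)) ⟩
      Σᵥ (λ b → 𝟙 (bad b) * (n * n)) + Σᵥ (λ b → K * D * e b (left b) (right b))
        ≡⟨ sym (Σ-+ _ _) ⟩
      Σᵥ (λ b → 𝟙 (bad b) * (n * n) + K * D * e b (left b) (right b))
        ≤⟨ Σ-mono deficit ⟩
      Σᵥ (λ b → K * (⟪ left b ⟫ * ⟪ right b ⟫))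
        ≡⟨ trans (Σ-*ˡ K _) (cong (K *_) (sym P₂-links)) ⟩
      K * |P₂| G₁ G₂ ∎
      where open ≤-Reasoning

    -- By `deficit-sum` every bad vertex adds n² to the total deficit K·|P₂| - K·D·e of the combined
    -- violating pairs, whereas cherry density with error n³/(KDM) bounds this deficit by n³/M.
    few-bad : .{{_ : NonZero n}} → M * ⟪ bad ⟫ ≤ n
    few-bad = *-cancelʳ-≤ (M * ⟪ bad ⟫) n (D * (n * n)) {{m*n≢0 D (n * n) {{it}} {{m*n≢0 n n}}}}
      (lin 0 (+-mono-≤ (*-monoʳ-≤ (D * M) deficit-sum) (cherry G₁ G₂))
        (identity D K M n ⟪ bad ⟫ (|P₂| G₁ G₂) (eH H G₁ G₂)))
      where
      identity : ∀ D K M n β p q →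
        M * β * (D * (n * n)) + (D * M * (K * p) + (D * (K * D * M) * q + D * (n * (n * (n * 1))))) + 0 ≡
        n * (D * (n * n)) + (D * M * (n * n * β + K * D * q) + K * D * M * p)
      identity = solve-∀

-- Choosing and connecting vertices

minority-rest : ∀ x o l₁ l₂ → x ≤ o + (l₁ + l₂) → 2 * l₁ < x → 2 * l₂ < x → 0 < o
minority-rest x o l₁ l₂ split h₁ h₂ = *-cancelˡ-≤ 2 (lin 0 (+-mono-≤ (*-monoʳ-≤ 2 split) (+-mono-≤ h₁ h₂))
  (identity x o l₁ l₂))
  where
  identity : ∀ x o l₁ l₂ → 2 * 1 + (2 * (o + (l₁ + l₂)) + (x + x)) + 0 ≡ 2 * o + (2 * x + (suc (2 * l₁) + suc (2 * l₂)))
  identity = solve-∀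

module Extend {n : ℕ} (H : 3Graph n) (D C K : ℕ) .{{_ : NonZero n}} .{{_ : NonZero D}}
  (K-large : 4 * ((D * C) * (D * C)) < K) where
  open Link H

  Big : VSet n → Set
  Big X = n ≤ C * ⟪ X ⟫

  big-≤ : ∀ {c} (X : VSet n) → c ≤ C → n ≤ c * ⟪ X ⟫ → Big X
  big-≤ X c≤C h = ≤-trans h (*-monoˡ-≤ ⟪ X ⟫ c≤C)

  scaled : ∀ x y → n ≤ C * x → x ≤ 2 * D * y → n ≤ 2 * (D * C) * y
  scaled x y h h′ = ≤-trans h (≤-trans (*-monoʳ-≤ C h′) (≤-reflexive (identity C D y)))
    where
    identity : ∀ C D y → C * (2 * D * y) ≡ 2 * (D * C) * y
    identity = solve-∀

  -- This is what `K-large` is calibrated for: the error n² in goodness stays below the main term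
  -- even for two big sets that have both lost a factor 2D.
  square<K : ∀ x y → n ≤ 2 * (D * C) * x → n ≤ 2 * (D * C) * y → n * n < K * (x * y)
  square<K x y hx hy = begin-strict
    n * n                                         ≤⟨ *-mono-≤ hx hy ⟩
    2 * (D * C) * x * (2 * (D * C) * y)           ≡⟨ identity (D * C) x y ⟩
    4 * ((D * C) * (D * C)) * (x * y)             <⟨ *-monoˡ-< (x * y) {{>-nonZero (pos x y hx hy)}} K-large ⟩
    K * (x * y)                                   ∎
    where
    open ≤-Reasoning
    identity : ∀ c x y → 2 * c * x * (2 * c * y) ≡ 4 * (c * c) * (x * y)
    identity = solve-∀
    vanishing : ¬ (n ≤ 2 * (D * C) * 0)
    vanishing h = contradiction (≤-trans h (≤-reflexive (*-zeroʳ (2 * (D * C))))) (<⇒≱ (>-nonZero⁻¹ n))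
    pos : ∀ x y → n ≤ 2 * (D * C) * x → n ≤ 2 * (D * C) * y → 0 < x * y
    pos zero    _       hx _  = contradiction hx vanishing
    pos (suc _) zero    _  hy = contradiction hy vanishing
    pos (suc _) (suc _) _  _  = s≤s z≤n

  -- The threshold |Z|/2D is half of the average |Z|/D that a good `b` guarantees up to the error.
  low : Fin n → VSet n → VSet n
  low b Z x = 2 * D * ⟪ N b x Z ⟫ <ᵇ ⟪ Z ⟫

  _∩_ : VSet n → VSet n → VSet n
  (X ∩ Y) v = X v ∧ Y v

  -- Between the low vertices and `Z` the link of `b` has at most half of the density 1/D, so the
  -- missing half must be paid for by the error n²/K.
  low-sparse : ∀ {b} → Good D K b → ∀ X Z → K * (⟪ X ∩ low b Z ⟫ * ⟪ Z ⟫) ≤ 2 * (n * n)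
  low-sparse {b} good X Z = lin 0 (+-mono-≤ (*-monoʳ-≤ 2 (good X′ Z)) (*-monoʳ-≤ K few-edges))
    (identity K D ⟪ X′ ⟫ ⟪ Z ⟫ (e b X′ Z) (n * n))
    where
    X′ : VSet n
    X′ = X ∩ low b Z
    pt : ∀ x → 2 * D * (𝟙 (X′ x) * ⟪ N b x Z ⟫) ≤ 𝟙 (X′ x) * ⟪ Z ⟫
    pt x = go (X′ x) λ p → <⇒≤ (<ᵇ-true _ ⟪ Z ⟫ (proj₂ (∧-true {X x} p)))
      where
      go : ∀ c → (c ≡ true → 2 * D * ⟪ N b x Z ⟫ ≤ ⟪ Z ⟫) → 2 * D * (𝟙 c * ⟪ N b x Z ⟫) ≤ 𝟙 c * ⟪ Z ⟫
      go false _ = ≤-reflexive (*-zeroʳ (2 * D))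
      go true  h = subst₂ _≤_ (cong (2 * D *_) (sym (*-identityˡ _))) (sym (*-identityˡ _)) (h refl)
    few-edges : 2 * D * e b X′ Z ≤ ⟪ X′ ⟫ * ⟪ Z ⟫
    few-edges = ≤-trans (≤-reflexive (sym (Σ-*ˡ (2 * D) _))) (≤-trans (Σ-mono pt) (≤-reflexive (Σ-*ʳ ⟪ Z ⟫ _)))
    identity : ∀ K D x z q m → K * (x * z) + (2 * (K * D * q + m) + K * (x * z)) + 0 ≡
      2 * m + (2 * (K * (x * z)) + K * (2 * D * q))
    identity = solve-∀

  few-low : ∀ {b} → Good D K b → ∀ X Z → Big X → Big Z → 2 * ⟪ X ∩ low b Z ⟫ < ⟪ X ⟫
  few-low {b} good X Z bigX bigZ = ≰⇒> λ le → <⇒≱ key (≤-trans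
    (≤-trans (*-monoʳ-≤ K (*-monoˡ-≤ ⟪ Z ⟫ le)) (≤-reflexive (identity K ⟪ X ∩ low b Z ⟫ ⟪ Z ⟫)))
    (*-monoʳ-≤ 2 (low-sparse good X Z)))
    where
    identity : ∀ K x z → K * (2 * x * z) ≡ 2 * (K * (x * z))
    identity = solve-∀
    instance
      xz≢0 : NonZero (⟪ X ⟫ * ⟪ Z ⟫)
      xz≢0 = m*n≢0 ⟪ X ⟫ ⟪ Z ⟫ {{nz X bigX}} {{nz Z bigZ}}
        where
        nz : ∀ Y → Big Y → NonZero ⟪ Y ⟫
        nz Y h with ⟪ Y ⟫
        ... | suc _ = _
        ... | zero  = contradiction (≤-trans h (≤-reflexive (*-zeroʳ C))) (<⇒≱ (>-nonZero⁻¹ n))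
    key : 2 * (2 * (n * n)) < K * (⟪ X ⟫ * ⟪ Z ⟫)
    key = begin-strict
      2 * (2 * (n * n))                                ≤⟨ *-monoʳ-≤ 2 (*-monoʳ-≤ 2 (*-mono-≤ bigX bigZ)) ⟩
      2 * (2 * (C * ⟪ X ⟫ * (C * ⟪ Z ⟫)))              ≡⟨ regroup C ⟪ X ⟫ ⟪ Z ⟫ ⟩
      4 * (C * C) * (⟪ X ⟫ * ⟪ Z ⟫)                    ≤⟨ *-monoˡ-≤ (⟪ X ⟫ * ⟪ Z ⟫) (*-monoʳ-≤ 4 (*-mono-≤ C≤ C≤)) ⟩
      4 * ((D * C) * (D * C)) * (⟪ X ⟫ * ⟪ Z ⟫)        <⟨ *-monoˡ-< (⟪ X ⟫ * ⟪ Z ⟫) K-large ⟩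
      K * (⟪ X ⟫ * ⟪ Z ⟫)                              ∎
      where
      open ≤-Reasoning
      C≤ : C ≤ D * C
      C≤ = m≤n*m C D
      regroup : ∀ C x z → 2 * (2 * (C * x * (C * z))) ≡ 4 * (C * C) * (x * z)
      regroup = solve-∀

  opaque
    -- Each of the two requirements excludes less than half of `X`, so both can be met at once: one
    -- may keep the path extendable while the other steers it towards a target, or they may look
    -- towards the two ends to be joined.
    pick : ∀ {b₁ b₂} → Good D K b₁ → Good D K b₂ → ∀ X Z₁ Z₂ → Big X → Big Z₁ → Big Z₂ →
      ∃ λ x → X x ≡ true × ⟪ Z₁ ⟫ ≤ 2 * D * ⟪ N b₁ x Z₁ ⟫ × ⟪ Z₂ ⟫ ≤ 2 * D * ⟪ N b₂ x Z₂ ⟫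
    pick {b₁} {b₂} good₁ good₂ X Z₁ Z₂ bigX big₁ big₂ =
      unpack (card-witness ok ok-pos)
      where
      ok : VSet n
      ok x = X x ∧ (not (low b₁ Z₁ x) ∧ not (low b₂ Z₂ x))
      bool : ∀ a b c → 𝟙 a ≤ 𝟙 (a ∧ (not b ∧ not c)) + (𝟙 (a ∧ b) + 𝟙 (a ∧ c))
      bool false _     _     = z≤n
      bool true  true  _     = s≤s z≤n
      bool true  false true  = s≤s z≤n
      bool true  false false = s≤s z≤n
      split : ⟪ X ⟫ ≤ ⟪ ok ⟫ + (⟪ X ∩ low b₁ Z₁ ⟫ + ⟪ X ∩ low b₂ Z₂ ⟫)
      split = ≤-trans (Σ-mono λ x → bool (X x) (low b₁ Z₁ x) (low b₂ Z₂ x)) (≤-reflexive (trans (Σ-+ _ _) (cong (⟪ ok ⟫ +_) (Σ-+ _ _))))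
      ok-pos : 0 < ⟪ ok ⟫
      ok-pos = minority-rest ⟪ X ⟫ ⟪ ok ⟫ ⟪ X ∩ low b₁ Z₁ ⟫ ⟪ X ∩ low b₂ Z₂ ⟫ split (few-low good₁ X Z₁ bigX big₁) (few-low good₂ X Z₂ bigX big₂)
      high : ∀ b Z x → not (low b Z x) ≡ true → ⟪ Z ⟫ ≤ 2 * D * ⟪ N b x Z ⟫
      high b Z x p = <ᵇ-false _ ⟪ Z ⟫ (not-true p)
      unpack : (∃ λ x → ok x ≡ true) →
        ∃ λ x → X x ≡ true × ⟪ Z₁ ⟫ ≤ 2 * D * ⟪ N b₁ x Z₁ ⟫ × ⟪ Z₂ ⟫ ≤ 2 * D * ⟪ N b₂ x Z₂ ⟫
      unpack (x , okx) =
        let Xx , rest = ∧-true {X x} okx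
            p₁ , p₂ = ∧-true {not (low b₁ Z₁ x)} rest
        in x , Xx , high b₁ Z₁ x p₁ , high b₂ Z₂ x p₂

  opaque
    -- The middle vertex `y` comes first, chosen with many partners in `X` through `a` and many in
    -- `Z` through `t`. As `y` is good too, its link has an edge xz between the two sets of
    -- partners, which gives the stretch a x y z t.
    connect : ∀ {a t} → Good D K a → Good D K t → ∀ X Y Z → Big X → Big Y → Big Z →
      (∀ y → Y y ≡ true → Good D K y) →
      ∃ λ x → ∃ λ y → ∃ λ z → X x ≡ true × Y y ≡ true × Z z ≡ true × E a x y × E x y z × E t z y
    connect {a} {t} good-a good-t X Y Z bigX bigY bigZ good-Y = through (pick good-a good-t Y X Z bigY bigX bigZ)
      where
      Goal : Set
      Goal = ∃ λ x → ∃ λ y → ∃ λ z → X x ≡ true × Y y ≡ true × Z z ≡ true × E a x y × E x y z × E t z y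

      factors : ∀ b m → 0 < 𝟙 b * m → b ≡ true × 0 < m
      factors true m lt = refl , subst (0 <_) (*-identityˡ m) lt

      finish : ∀ {x y z} → Y y ≡ true → N a y X x ≡ true → N y x (N t y Z) z ≡ true → Goal
      finish {x} {y} {z} Yy x∈ z∈ =
        let Xx , ayx = N-elim a y X x∈
            z∈′ , yxz = N-elim y x (N t y Z) z∈
            Zz , tyz = N-elim t y Z z∈′
        in x , y , z , Xx , Yy , Zz , E₂₃ ayx , E₁₂ yxz , E₂₃ tyz

      through : (∃ λ y → Y y ≡ true × ⟪ X ⟫ ≤ 2 * D * ⟪ N a y X ⟫ × ⟪ Z ⟫ ≤ 2 * D * ⟪ N t y Z ⟫) → Goal
      through (y , Yy , degX , degZ) =
        let x , p = Σ-pos (λ x → 𝟙 (N a y X x) * ⟪ N y x (N t y Z) ⟫)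
                      (pos (e y (N a y X) (N t y Z)) (good-Y y Yy (N a y X) (N t y Z)))
            x∈ , z-pos = factors (N a y X x) ⟪ N y x (N t y Z) ⟫ p
            z , z∈ = card-witness (N y x (N t y Z)) z-pos
        in finish Yy x∈ z∈
        where
        pos : ∀ q → K * (⟪ N a y X ⟫ * ⟪ N t y Z ⟫) ≤ K * D * q + n * n → 0 < q
        pos (suc q) _ = s≤s z≤n
        pos zero    h = contradiction (≤-trans h (≤-reflexive (cong (_+ n * n) (*-zeroʳ (K * D)))))
          (<⇒≱ (square<K ⟪ N a y X ⟫ ⟪ N t y Z ⟫ (scaled ⟪ X ⟫ ⟪ N a y X ⟫ bigX degX) (scaled ⟪ Z ⟫ ⟪ N t y Z ⟫ bigZ degZ)))

-- Absorbing gadgets and the passage from a list to a cycle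

module Absorption {n : ℕ} (H : 3Graph n) where
  open Link H

  TightFrom : Fin n → Fin n → List (Fin n) → Set
  TightFrom a b []      = ⊤
  TightFrom a b (c ∷ L) = E a b c × TightFrom b c L

  -- gad a b c d is a stretch of four path vertices reserved for absorbing one vertex between b and c.
  data Seg : Set where
    pt  : Fin n → Seg
    gad : (a b c d : Fin n) → Seg

  flat : List Seg → List (Fin n)
  flat []               = []
  flat (pt x ∷ s)        = x ∷ flat s
  flat (gad a b c d ∷ s) = a ∷ b ∷ c ∷ d ∷ flat s

  -- Up to order these are the triples abv, bvc, vcd that arise when `v` is put between `b` and `c`.
  absorbs : (a b c d v : Fin n) → Bool
  absorbs a b c d v = edge H a b v ∧ (edge H b c v ∧ edge H c d v)

  cnt : Fin n → List Seg → ℕ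
  cnt v []               = 0
  cnt v (pt x ∷ s)        = cnt v s
  cnt v (gad a b c d ∷ s) = 𝟙 (absorbs a b c d v) + cnt v s

  -- One absorption consumes one gadget, so any vertex loses at most one from its count. The first
  -- two and the last two vertices of the gadget stay adjacent, so tightness persists in every
  -- context.
  record Absorbed (v : Fin n) (s : List Seg) : Set where
    constructor absorbed
    field
      result : List Seg
      cnt-≤  : ∀ u → cnt u s ≤ suc (cnt u result)
      occ-≡  : ∀ u → occ u (flat result) ≡ 𝟙 (u == v) + occ u (flat s)
      tight  : ∀ a b M → TightFrom a b (flat s ++ M) → TightFrom a b (flat result ++ M)

  absorb : ∀ v s → 0 < cnt v s → Absorbed v s
  absorb v (pt x ∷ s) 0<cnt with absorb v s 0<cnt
  ... | absorbed s′ c o t = absorbed (pt x ∷ s′) c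
    (λ u → trans (cong (𝟙 (u == x) +_) (o u)) (swap (𝟙 (u == x)) (𝟙 (u == v)) _))
    (λ a b M (e , rest) → e , t b x M rest)
    where
    swap : ∀ a b c → a + (b + c) ≡ b + (a + c)
    swap = solve-∀
  absorb v (gad a b c d ∷ s) 0<cnt with absorbs a b c d v in eq
  ... | true = absorbed (pt a ∷ pt b ∷ pt v ∷ pt c ∷ pt d ∷ s)
    (λ u → +-monoˡ-≤ (cnt u s) (𝟙-≤ {absorbs a b c d u} λ _ → ≤-refl))
    (λ u → swap (𝟙 (u == a)) (𝟙 (u == b)) (𝟙 (u == v)) _)
    λ { x y M (e₁ , e₂ , e₃ , e₄ , rest) →
        let abv , bcv,cdv = ∧-true eq
            bcv , cdv = ∧-true {edge H b c v} bcv,cdv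
        in e₁ , e₂ , abv , E₂₃ bcv , E₁₂ (E₂₃ cdv) , rest }
    where
    swap : ∀ a b v c → a + (b + (v + c)) ≡ v + (a + (b + c))
    swap = solve-∀
  ... | false with absorb v s 0<cnt
  ...   | absorbed s′ c′ o t = absorbed (gad a b c d ∷ s′)
    (λ u → ≤-trans (+-monoʳ-≤ _ (c′ u)) (≤-reflexive (+-suc (𝟙 (absorbs a b c d u)) _)))
    (λ u → trans (cong (λ q → 𝟙 (u == a) + (𝟙 (u == b) + (𝟙 (u == c) + (𝟙 (u == d) + q)))) (o u))
      (swap (𝟙 (u == a)) (𝟙 (u == b)) (𝟙 (u == c)) (𝟙 (u == d)) (𝟙 (u == v)) _))
    λ { x y M (e₁ , e₂ , e₃ , e₄ , rest) → e₁ , e₂ , e₃ , e₄ , t c d M rest }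
    where
    swap : ∀ a b c d v r → a + (b + (c + (d + (v + r)))) ≡ v + (a + (b + (c + (d + r))))
    swap = solve-∀

  Simple : List (Fin n) → Set
  Simple L = ∀ v → occ v L ≤ 1

  unused : List (Fin n) → VSet n
  unused = avail (λ _ → false)

  -- Repeating the first two vertices `z`, `y` at the end expresses that the tight path closes up to
  -- a cycle.
  HamiltonList : Set
  HamiltonList = ∃ λ z → ∃ λ y → ∃ λ l → TightFrom z y (l ++ z ∷ y ∷ []) × (∀ v → occ v (z ∷ y ∷ l) ≡ 1)

  absorb-all : ∀ m z y s → ⟪ unused (z ∷ y ∷ flat s) ⟫ ≡ m → Simple (z ∷ y ∷ flat s) →
    TightFrom z y (flat s ++ z ∷ y ∷ []) →
    (∀ v → occ v (z ∷ y ∷ flat s) ≡ 0 → m ≤ cnt v s) →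
    ∃ λ l → TightFrom z y (l ++ z ∷ y ∷ []) × (∀ v → occ v (z ∷ y ∷ l) ≡ 1)
  absorb-all zero z y s m≡ simple tight absorbable =
    flat s , tight , λ v → ≤-antisym (simple v) (n≢0⇒n>0 λ v∉ →
      contradiction (trans (sym (avail-intro (λ _ → false) (z ∷ y ∷ flat s) v refl v∉)) (card-empty _ m≡ v)) λ ())
  absorb-all (suc m) z y s m≡ simple tight absorbable =
    let v , v∈ = card-witness (unused (z ∷ y ∷ flat s)) (subst (0 <_) (sym m≡) (s≤s z≤n))
        _ , v∉ = avail-elim (λ _ → false) (z ∷ y ∷ flat s) v v∈
    in step v v∈ v∉ (absorb v s (≤-trans (s≤s z≤n) (absorbable v v∉)))
    where
    step : ∀ v → unused (z ∷ y ∷ flat s) v ≡ true → occ v (z ∷ y ∷ flat s) ≡ 0 → Absorbed v s →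
      ∃ λ l → TightFrom z y (l ++ z ∷ y ∷ []) × (∀ v → occ v (z ∷ y ∷ l) ≡ 1)
    step v v∈ v∉ (absorbed s′ c o t) = absorb-all m z y s′ card′ simple′ (t z y _ tight) absorbable′
      where
      occ′ : ∀ u → occ u (z ∷ y ∷ flat s′) ≡ 𝟙 (u == v) + occ u (z ∷ y ∷ flat s)
      occ′ u = trans (cong (λ q → 𝟙 (u == z) + (𝟙 (u == y) + q)) (o u)) (swap (𝟙 (u == z)) (𝟙 (u == y)) (𝟙 (u == v)) _)
        where
        swap : ∀ a b v r → a + (b + (v + r)) ≡ v + (a + (b + r))
        swap = solve-∀
      simple′ : Simple (z ∷ y ∷ flat s′)
      simple′ u = ≤-trans (≤-reflexive (occ′ u)) go
        where
        go : 𝟙 (u == v) + occ u (z ∷ y ∷ flat s) ≤ 1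
        go with u Fin.≟ v
        ... | yes refl = s≤s (≤-reflexive v∉)
        ... | no _     = simple u
      card′ : ⟪ unused (z ∷ y ∷ flat s′) ⟫ ≡ m
      card′ = suc-injective (trans (cong suc (Σ-cong λ u → cong 𝟙 (removed u))) (trans (card-∖ (unused (z ∷ y ∷ flat s)) v v∈) m≡))
        where
        removed : ∀ u → unused (z ∷ y ∷ flat s′) u ≡ (unused (z ∷ y ∷ flat s) ∖ v) u
        removed u rewrite occ′ u with u == v
        ... | true  = sym (∧-zeroʳ _)
        ... | false with occ u (z ∷ y ∷ flat s)
        ...   | zero  = refl
        ...   | suc _ = refl
      absorbable′ : ∀ u → occ u (z ∷ y ∷ flat s′) ≡ 0 → m ≤ cnt u s′
      absorbable′ u u∉ = s≤s⁻¹ (≤-trans (absorbable u (m+n≡0⇒n≡0 (𝟙 (u == v)) (trans (sym (occ′ u)) u∉))) (c u))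

  -- Reading a list as a cyclic order

  nth : Fin n → List (Fin n) → ℕ → Fin n
  nth x₀ []      i       = x₀
  nth x₀ (x ∷ L) zero    = x
  nth x₀ (x ∷ L) (suc i) = nth x₀ L i

  nth-++ˡ : ∀ x₀ L M i → i < length L → nth x₀ (L ++ M) i ≡ nth x₀ L i
  nth-++ˡ x₀ (x ∷ L) M zero    _         = refl
  nth-++ˡ x₀ (x ∷ L) M (suc i) (s≤s i<L) = nth-++ˡ x₀ L M i i<L

  nth-++ʳ : ∀ x₀ L M i → nth x₀ (L ++ M) (length L + i) ≡ nth x₀ M i
  nth-++ʳ x₀ []      M i = refl
  nth-++ʳ x₀ (x ∷ L) M i = nth-++ʳ x₀ L M i

  occ-pos : ∀ x₀ L i → i < length L → 0 < occ (nth x₀ L i) L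
  occ-pos x₀ (x ∷ L) zero    _         rewrite ==-refl x = s≤s z≤n
  occ-pos x₀ (x ∷ L) (suc i) (s≤s i<L) = ≤-trans (occ-pos x₀ L i i<L) (m≤n+m _ _)

  nth-injective : ∀ x₀ L → Simple L → ∀ i j → i < length L → j < length L → nth x₀ L i ≡ nth x₀ L j → i ≡ j
  nth-injective x₀ (x ∷ L) simple zero    zero    _ _ _ = refl
  nth-injective x₀ (x ∷ L) simple zero    (suc j) _ (s≤s j<) eq =
    contradiction (≤-trans (+-mono-≤ (≤-reflexive (sym (cong 𝟙 (==-refl x)))) (subst (λ u → 0 < occ u L) (sym eq) (occ-pos x₀ L j j<))) (simple x)) λ { (s≤s ()) }
  nth-injective x₀ (x ∷ L) simple (suc i) zero    (s≤s i<) _ eq =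
    contradiction (≤-trans (+-mono-≤ (≤-reflexive (sym (cong 𝟙 (==-refl x)))) (subst (λ u → 0 < occ u L) eq (occ-pos x₀ L i i<))) (simple x)) λ { (s≤s ()) }
  nth-injective x₀ (x ∷ L) simple (suc i) (suc j) (s≤s i<) (s≤s j<) eq =
    cong suc (nth-injective x₀ L (λ v → ≤-trans (m≤n+m _ _) (simple v)) i j i< j< eq)

  nth-surjective : ∀ x₀ L v → 0 < occ v L → ∃ λ i → i < length L × nth x₀ L i ≡ v
  nth-surjective x₀ (x ∷ L) v 0<occ with v Fin.≟ x
  ... | yes refl = 0 , s≤s z≤n , refl
  ... | no _ with nth-surjective x₀ L v 0<occ
  ...   | i , i< , eq = suc i , s≤s i< , eq

  nth-tight : ∀ x₀ a b L i → i < length L → TightFrom a b L →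
    E (nth x₀ (a ∷ b ∷ L) i) (nth x₀ (a ∷ b ∷ L) (1 + i)) (nth x₀ (a ∷ b ∷ L) (2 + i))
  nth-tight x₀ a b (c ∷ L) zero    _        (e , _)    = e
  nth-tight x₀ a b (c ∷ L) (suc i) (s≤s i<) (_ , rest) = nth-tight x₀ b c L i i< rest

toℕ-csuc : ∀ {m} (i : Fin (suc m)) → (suc (toℕ i) < suc m × toℕ (csuc i) ≡ suc (toℕ i)) ⊎ (suc (toℕ i) ≡ suc m × toℕ (csuc i) ≡ 0)
toℕ-csuc {m} i with m≤n⇒m<n∨m≡n (Fin.toℕ<n i)
... | inj₁ lt = inj₁ (lt , trans (Fin.toℕ-fromℕ< _) (m<n⇒m%n≡m lt))
... | inj₂ eq = inj₂ (eq , trans (Fin.toℕ-fromℕ< _) (trans (cong (_% suc m) eq) (n%n≡0 (suc m))))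

module _ {m : ℕ} (H : 3Graph (suc m)) where
  open Link H
  open Absorption H

  -- In the list `L⁺`, prolonged by its first two entries, the triples that wrap around are ordinary
  -- consecutive triples, so `nth-tight` covers all of them.
  tight-cycle : ∀ z y l → TightFrom z y (l ++ z ∷ y ∷ []) → (∀ v → occ v (z ∷ y ∷ l) ≡ 1) → HasTightHamCycle H
  tight-cycle z y l tight once = σ , (injective , surjective) , edges
    where
    L L⁺ : List (Fin (suc m))
    L = z ∷ y ∷ l
    L⁺ = L ++ z ∷ y ∷ []
    at : ℕ → Fin (suc m)
    at = nth z L⁺
    σ : Fin (suc m) → Fin (suc m)
    σ i = at (toℕ i)
    length-L : length L ≡ suc m
    length-L = trans (sym (Σ-occ L)) (trans (Σ-cong once) Σ-one)
    toℕ<L : ∀ i → toℕ i < length L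
    toℕ<L i = subst (toℕ i <_) (sym length-L) (Fin.toℕ<n i)
    at-L : ∀ i → i < length L → at i ≡ nth z L i
    at-L i = nth-++ˡ z L _ i
    injective : ∀ {i j} → σ i ≡ σ j → i ≡ j
    injective {i} {j} eq = Fin.toℕ-injective (nth-injective z L (λ v → ≤-reflexive (once v)) _ _ (toℕ<L i) (toℕ<L j)
      (trans (sym (at-L _ (toℕ<L i))) (trans eq (at-L _ (toℕ<L j)))))
    surjective : ∀ v → ∃ λ i → ∀ {j} → j ≡ i → σ j ≡ v
    surjective v =
      let i , i< , eq = nth-surjective z L v (≤-reflexive (sym (once v)))
          i<m = subst (i <_) length-L i<
      in fromℕ< i<m , λ { refl → trans (cong at (Fin.toℕ-fromℕ< i<m)) (trans (at-L i i<) eq) }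
    at-wrap : ∀ j → at (suc m + j) ≡ nth z (z ∷ y ∷ []) j
    at-wrap j = trans (cong (λ q → at (q + j)) (sym length-L)) (nth-++ʳ z L _ j)
    at-csuc : ∀ i → σ (csuc i) ≡ at (suc (toℕ i))
    at-csuc i with toℕ-csuc i
    ... | inj₁ (_ , eq)   = cong at eq
    ... | inj₂ (eq , eq′) = trans (cong at eq′) (sym (trans (cong at (trans eq (sym (+-identityʳ (suc m))))) (at-wrap 0)))
    at-csuc² : ∀ i → σ (csuc (csuc i)) ≡ at (2 + toℕ i)
    at-csuc² i with toℕ-csuc i
    ... | inj₁ (_ , eq)   = trans (at-csuc (csuc i)) (cong (λ q → at (suc q)) eq)
    ... | inj₂ (eq , eq′) = trans (at-csuc (csuc i)) (trans (cong (λ q → at (suc q)) eq′)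
      (sym (trans (cong at (trans (cong suc eq) (+-comm 1 (suc m)))) (at-wrap 1))))
    edges : ∀ i → edge H (σ i) (σ (csuc i)) (σ (csuc (csuc i))) ≡ true
    edges i rewrite at-csuc i | at-csuc² i = nth-tight z z y (l ++ z ∷ y ∷ []) (toℕ i)
      (subst (toℕ i <_) (sym (trans (length-++ l) (trans (+-comm (length l) 2) length-L))) (Fin.toℕ<n i)) tight

-- Growing a path of absorbing gadgets

half : ∀ n w u → n ≤ w + u → 2 * u ≤ n → n ≤ 2 * w
half n w u h h′ = lin 0 (+-mono-≤ (*-monoʳ-≤ 2 h) h′) (identity n w u)
  where
  identity : ∀ n w u → n + (2 * (w + u) + n) + 0 ≡ 2 * w + (2 * n + 2 * u)
  identity = solve-∀

-- A set of size n/c that loses at most n/2c elements keeps at least half of this bound.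
shrink : ∀ n c m x y → n ≤ c * x → x ≤ y + m → 2 * c * m ≤ n → n ≤ 2 * c * y
shrink n c m x y h h′ h″ = lin 0 (+-mono-≤ (+-mono-≤ (*-monoʳ-≤ 2 h) (*-monoʳ-≤ (2 * c) h′)) h″) (identity n c m x y)
  where
  identity : ∀ n c m x y → n + (2 * (c * x) + 2 * c * (y + m) + n) + 0 ≡ 2 * c * y + (2 * n + 2 * c * x + 2 * c * m)
  identity = solve-∀

module Growth {n : ℕ} (H : 3Graph n) (D C K : ℕ) .{{_ : NonZero n}} .{{_ : NonZero D}}
  (K-large : 4 * ((D * C) * (D * C)) < K) (p q : Fin n) where
  open Link H
  open Extend H D C K K-large
  open Absorption H

  V : Set
  V = Fin n

  E⇒≢₁₂ : ∀ {x y z} → E x y z → x ≢ y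
  E⇒≢₁₂ = dist₁₂ H _ _ _

  E⇒≢₂₃ : ∀ {x y z} → E x y z → y ≢ z
  E⇒≢₂₃ = dist₂₃ H _ _ _

  E⇒≢₁₃ : ∀ {x y z} → E x y z → x ≢ z
  E⇒≢₁₃ = dist₁₃ H _ _ _

  -- The path a, b, r (newest vertex first) whose far end is the pair p, q.
  record Path (a b : V) (r : List V) : Set where
    constructor mkPath
    field
      simple : Simple (a ∷ b ∷ r)
      tight  : ∀ M → TightFrom p q M → TightFrom a b (r ++ M)

  path-∷ : ∀ {x a b r} → Path a b r → E x a b → occ x (a ∷ b ∷ r) ≡ 0 → Path x a (b ∷ r)
  path-∷ {x} {a} {b} {r} (mkPath simple tight) xab x∉ = mkPath simple′ λ M t → xab , tight M t
    where
    simple′ : Simple (x ∷ a ∷ b ∷ r)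
    simple′ v with v Fin.≟ x
    ... | yes refl = s≤s (≤-reflexive x∉)
    ... | no _     = simple v

  avail-++ : ∀ F xs L (v : V) → avail F L v ≡ true → occ v xs ≡ 0 → avail F (xs ++ L) v ≡ true
  avail-++ F xs L v v∈ v∉xs =
    let Fv , v∉L = avail-elim F L v v∈
    in avail-intro F (xs ++ L) v Fv (trans (occ-++ v xs L) (cong₂ _+_ v∉xs v∉L))

  N-without : ∀ F xs L a b → ⟪ N a b (avail F L) ⟫ ≤ ⟪ N a b (avail F (xs ++ L)) ⟫ + length xs
  N-without F xs L a b = card-without xs _ _ λ v v∈ v∉ →
    let v∈W , abv = N-elim a b (avail F L) v∈
    in N-intro (avail F (xs ++ L)) (avail-++ F xs L v v∈W v∉) abv

  N-swap : ∀ a b Z → ⟪ N a b Z ⟫ ≤ ⟪ N b a Z ⟫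
  N-swap a b Z = card-mono _ _ λ v v∈ → let Zv , abv = N-elim a b Z v∈ in N-intro Z Zv (E₁₂ abv)

  -- Putting `x` on the path costs no continuation, because `x` forms no edge with the pair `a`, `x`
  -- itself.
  N-step : ∀ F L a x → ⟪ N a x (avail F L) ⟫ ≤ ⟪ N x a (avail F (x ∷ L)) ⟫
  N-step F L a x = card-mono _ _ λ v v∈ →
    let v∈W , axv = N-elim a x (avail F L) v∈
    in N-intro (avail F (x ∷ L)) (avail-++ F (x ∷ []) L v v∈W (fresh-∷ {L = []} (E⇒≢₂₃ axv ∘ sym) refl)) (E₁₂ axv)

  -- `F` restricts the new vertex and `F′` the continuations counted after it; they differ at the
  -- passage from stocking gadgets to inserting. `S` is a target that the pair `a`, `new` has to
  -- hit.
  record Extension (a b : V) (r : List V) (F F′ S : VSet n) : Set where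
    constructor extension
    field
      new      : V
      new∈     : avail F (a ∷ b ∷ r) new ≡ true
      new-path : Path new a (b ∷ r)
      onward   : ⟪ avail F′ (a ∷ b ∷ r) ⟫ ≤ 2 * D * ⟪ N new a (avail F′ (new ∷ a ∷ b ∷ r)) ⟫
      hits     : ⟪ S ⟫ ≤ 2 * D * ⟪ N a new S ⟫

  extend : ∀ {a b r} → Path a b r → Good D K a → ∀ F F′ S →
    Big (N a b (avail F (a ∷ b ∷ r))) → Big (avail F′ (a ∷ b ∷ r)) → Big S → Extension a b r F F′ S
  extend {a} {b} {r} P good F F′ S bigN bigW bigS =
    let x , x∈ , deg , hits = pick good good (N a b (avail F L)) (avail F′ L) S bigN bigW bigS
        x∈W , abx = N-elim a b (avail F L) x∈
    in extension x x∈W (path-∷ P (E₁₂ (E₂₃ abx)) (proj₂ (avail-elim F L x x∈W)))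
         (≤-trans deg (*-monoʳ-≤ (2 * D) (N-step F′ L a x))) hits
    where
    L : List V
    L = a ∷ b ∷ r

  chain : ∀ c x y → n ≤ c * x → x ≤ 2 * D * y → n ≤ c * (2 * D) * y
  chain c x y h h′ = ≤-trans h (≤-trans (*-monoʳ-≤ c h′) (≤-reflexive (sym (*-assoc c (2 * D) y))))

  -- Each of the three consecutive pairs of a gadget shrinks a set of n/Ξ unsaturated vertices by a
  -- factor of at most 2D, which leaves n/J; `k` is the number of gadgets wanted for every vertex.
  module Absorbers (Hc Ξ J k : ℕ) (bad : VSet n) (not-bad : ∀ v → bad v ≡ false → Good D K v)
    (J-def : J ≡ Ξ * (2 * D) * (2 * D) * (2 * D)) (J≤C : J ≤ C) (Hc≤C : Hc ≤ C) (4D≤Hc : 2 * (2 * D) ≤ Hc)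
    (room : 2 * (⟪ bad ⟫ + (6 + 4 * (J * k))) ≤ n) where

    Head : V → V → List V → Set
    Head a b r = n ≤ Hc * ⟪ N a b (avail bad (a ∷ b ∷ r)) ⟫

    2D≥1 : 1 ≤ 2 * D
    2D≥1 = >-nonZero⁻¹ (2 * D) {{m*n≢0 2 D}}

    record Grown (a b : V) (r : List V) (S : VSet n) : Set where
      constructor grown
      field
        new  : V
        path : Path new a (b ∷ r)
        good : Good D K new
        head : Head new a (b ∷ r)
        hits : ⟪ S ⟫ ≤ 2 * D * ⟪ N a new S ⟫

    -- The head bound does not deteriorate along the path: the new continuations are measured
    -- against all available vertices, at least n/2 of them, and not against the old continuations.
    grow : ∀ {a b r} S → Path a b r → Good D K a → Head a b r → length (a ∷ b ∷ r) ≤ 6 + 4 * (J * k) → Big S → Grown a b r S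
    grow {a} {b} {r} S P good-a head len bigS = finish (extend P good-a bad bad S (big-≤ _ Hc≤C head) (big-≤ (avail bad L) (≤-trans 2≤Hc Hc≤C) n≤2W) bigS)
      where
      L : List V
      L = a ∷ b ∷ r
      2≤Hc : 2 ≤ Hc
      2≤Hc = ≤-trans (*-monoʳ-≤ 2 2D≥1) 4D≤Hc
      n≤2W : n ≤ 2 * ⟪ avail bad L ⟫
      n≤2W = half n ⟪ avail bad L ⟫ (⟪ bad ⟫ + length L) (card-avail-≥ bad L) (≤-trans (*-monoʳ-≤ 2 (+-monoʳ-≤ ⟪ bad ⟫ len)) room)
      finish : Extension a b r bad bad S → Grown a b r S
      finish (extension x x∈ P′ onward hits) = grown x P′ (not-bad x (proj₁ (avail-elim bad L x x∈)))
        (≤-trans (chain 2 ⟪ avail bad L ⟫ _ n≤2W onward) (*-monoˡ-≤ _ 4D≤Hc)) hits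

    caught : V → V → V → V → VSet n → VSet n
    caught a b c d S = N c d (N b c (N a b S))

    record Gadget (a b : V) (r : List V) (S : VSet n) : Set where
      constructor gadget
      field
        {q₁ q₂ q₃ q₄} : V
        path : Path q₄ q₃ (q₂ ∷ q₁ ∷ a ∷ b ∷ r)
        good : Good D K q₄
        head : Head q₄ q₃ (q₂ ∷ q₁ ∷ a ∷ b ∷ r)
        many : n ≤ J * ⟪ caught q₁ q₂ q₃ q₄ S ⟫

    -- The pairs q₁q₂, q₂q₃, q₃q₄ cut `S` down in turn: the target of each step is the part of `S`
    -- that survived the earlier pairs.
    add-gadget : ∀ {a b r} S → Path a b r → Good D K a → Head a b r → length (a ∷ b ∷ r) ≤ 2 + 4 * (J * k) → n ≤ Ξ * ⟪ S ⟫ →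
      Gadget a b r S
    add-gadget {a} {b} {r} S P good-a head len bigS =
      first (grow S P good-a head (≤-trans len (m≤n+m _ 4)) (big-≤ S Ξ≤C bigS))
      where
      Ξ₁ Ξ₂ : ℕ
      Ξ₁ = Ξ * (2 * D)
      Ξ₂ = Ξ₁ * (2 * D)
      instance
        2D≢0 : NonZero (2 * D)
        2D≢0 = m*n≢0 2 D
      Ξ₂≤C : Ξ₂ ≤ C
      Ξ₂≤C = ≤-trans (≤-trans (m≤m*n Ξ₂ (2 * D)) (≤-reflexive (sym J-def))) J≤C
      Ξ₁≤C : Ξ₁ ≤ C
      Ξ₁≤C = ≤-trans (m≤m*n Ξ₁ (2 * D)) Ξ₂≤C
      Ξ≤C : Ξ ≤ C
      Ξ≤C = ≤-trans (m≤m*n Ξ (2 * D)) Ξ₁≤C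
      longer : ∀ m → m ≤ 4 → m + length (a ∷ b ∷ r) ≤ 6 + 4 * (J * k)
      longer m m≤4 = +-mono-≤ m≤4 len

      fourth : ∀ {q₁ q₂ q₃} (S₂ : VSet n) → S₂ ≡ N q₂ q₃ (N q₁ q₂ S) → n ≤ Ξ₂ * ⟪ S₂ ⟫ → Grown q₃ q₂ (q₁ ∷ a ∷ b ∷ r) S₂ → Gadget a b r S
      fourth S₂ refl bigS₂ (grown q₄ P₄ good₄ head₄ hits) =
        gadget P₄ good₄ head₄ (≤-trans (chain Ξ₂ ⟪ S₂ ⟫ _ bigS₂ hits) (*-monoˡ-≤ _ (≤-reflexive (sym J-def))))

      third : ∀ {q₁ q₂} (S₁ : VSet n) → S₁ ≡ N q₁ q₂ S → n ≤ Ξ₁ * ⟪ S₁ ⟫ → Grown q₂ q₁ (a ∷ b ∷ r) S₁ → Gadget a b r S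
      third {q₁} {q₂} S₁ refl bigS₁ (grown q₃ P₃ good₃ head₃ hits) = fourth (N q₂ q₃ S₁) refl bigS₂
        (grow (N q₂ q₃ S₁) P₃ good₃ head₃ (longer 3 (s≤s (s≤s (s≤s z≤n)))) (big-≤ (N q₂ q₃ S₁) Ξ₂≤C bigS₂))
        where
        bigS₂ : n ≤ Ξ₂ * ⟪ N q₂ q₃ S₁ ⟫
        bigS₂ = chain Ξ₁ ⟪ S₁ ⟫ _ bigS₁ hits

      second : ∀ {q₁} → Grown q₁ a (b ∷ r) S → Gadget a b r S
      second {q₁} (grown q₂ P₂ good₂ head₂ hits) = third (N q₁ q₂ S) refl bigS₁
        (grow (N q₁ q₂ S) P₂ good₂ head₂ (longer 2 (s≤s (s≤s z≤n))) (big-≤ (N q₁ q₂ S) Ξ₁≤C bigS₁))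
        where
        bigS₁ : n ≤ Ξ₁ * ⟪ N q₁ q₂ S ⟫
        bigS₁ = chain Ξ ⟪ S ⟫ _ bigS hits

      first : Grown a b r S → Gadget a b r S
      first (grown q₁ P₁ good₁ head₁ _) = second (grow S P₁ good₁ head₁ (longer 1 (s≤s z≤n)) (big-≤ S Ξ≤C bigS))

    active : List Seg → VSet n
    active s v = cnt v s <ᵇ k

    -- The potential that bounds the number of stretches: how many gadgets are still lacking, summed
    -- over all vertices.
    deficiency : List Seg → ℕ
    deficiency s = Σᵥ λ v → k ∸ cnt v s

    -- A caught vertex is active, so its truncated difference really falls by one. The path is
    -- listed newest vertex first, which reverses the gadget.
    deficiency-drop : ∀ s q₁ q₂ q₃ q₄ →
      deficiency (gad q₄ q₃ q₂ q₁ ∷ s) + ⟪ caught q₁ q₂ q₃ q₄ (active s) ⟫ ≤ deficiency s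
    deficiency-drop s q₁ q₂ q₃ q₄ = ≤-trans (≤-reflexive (sym (Σ-+ _ _))) (Σ-mono drop)
      where
      drop : ∀ v → (k ∸ (𝟙 (absorbs q₄ q₃ q₂ q₁ v) + cnt v s)) + 𝟙 (caught q₁ q₂ q₃ q₄ (active s) v) ≤ k ∸ cnt v s
      drop v = go (absorbs q₄ q₃ q₂ q₁ v) (caught q₁ q₂ q₃ q₄ (active s) v) λ v∈ →
        let v∈₂ , e₃₄ = N-elim q₃ q₄ (N q₂ q₃ (N q₁ q₂ (active s))) v∈
            v∈₁ , e₂₃ = N-elim q₂ q₃ (N q₁ q₂ (active s)) v∈₂
            v∈₀ , e₁₂ = N-elim q₁ q₂ (active s) v∈₁
        in <ᵇ-true (cnt v s) k v∈₀ , ∧-intro (E₁₂ e₃₄) (∧-intro (E₁₂ e₂₃) (E₁₂ e₁₂))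
        where
        go : ∀ α β → (β ≡ true → cnt v s < k × α ≡ true) → (k ∸ (𝟙 α + cnt v s)) + 𝟙 β ≤ k ∸ cnt v s
        go α false _ = ≤-trans (≤-reflexive (+-identityʳ _)) (∸-monoʳ-≤ k (m≤n+m (cnt v s) (𝟙 α)))
        go α true  h with h refl
        ... | lt , refl = ≤-reflexive (trans (+-comm (k ∸ suc (cnt v s)) 1) (sym (+-∸-assoc 1 lt)))

    record Stocked : Set where
      constructor stocked
      field
        {a b}  : V
        {r}    : List V
        segs   : List Seg
        flat≡  : flat segs ≡ a ∷ b ∷ r
        path   : Path a b r
        good   : Good D K a
        head   : Head a b r
        len    : length (a ∷ b ∷ r) ≤ 2 + 4 * (J * k)
        few    : Ξ * ⟪ active segs ⟫ < n

    -- Each gadget lowers J·`deficiency` by at least n, and this quantity starts at no more than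
    -- Jkn. Hence at most Jk gadgets are added before fewer than n/Ξ vertices are active, and the
    -- fuel Jk + 1 cannot run out.
    stock : ∀ fuel j s {a b r} → flat s ≡ a ∷ b ∷ r → Path a b r → Good D K a → Head a b r →
      fuel + j ≡ suc (J * k) → length (a ∷ b ∷ r) ≡ 2 + 4 * j → J * deficiency s + j * n ≤ J * k * n → Stocked
    stock zero j s flat≡ P good-a head fuel≡ len pot =
      contradiction (*-cancelʳ-≤ _ _ n (≤-trans (m≤n+m (j * n) _) pot)) (<⇒≱ (≤-reflexive (sym fuel≡)))
    stock (suc fuel) j s {a} {b} {r} flat≡ P good-a head fuel≡ len pot = decide (n ≤? Ξ * ⟪ active s ⟫)
      where
      j≤ : j ≤ J * k
      j≤ = ≤-trans (m≤n+m j fuel) (≤-reflexive (suc-injective fuel≡))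
      len≤ : length (a ∷ b ∷ r) ≤ 2 + 4 * (J * k)
      len≤ = ≤-trans (≤-reflexive len) (+-monoʳ-≤ 2 (*-monoʳ-≤ 4 j≤))
      continue : Gadget a b r (active s) → Stocked
      continue (gadget {q₁} {q₂} {q₃} {q₄} P′ good′ head′ many) =
        stock fuel (suc j) (gad q₄ q₃ q₂ q₁ ∷ s) (cong (λ L → q₄ ∷ q₃ ∷ q₂ ∷ q₁ ∷ L) flat≡) P′ good′ head′
          (trans (+-suc fuel j) fuel≡) (trans (cong (4 +_) len) (len-identity j))
          (≤-trans (lin 0 (+-mono-≤ many (*-monoʳ-≤ J (deficiency-drop s q₁ q₂ q₃ q₄)))
            (pot-identity n J j _ _ (deficiency s))) pot)
        where
        len-identity : ∀ j → 4 + (2 + 4 * j) ≡ 2 + 4 * suc j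
        len-identity = solve-∀
        pot-identity : ∀ n J j d c d₀ → (J * d + suc j * n) + (J * c + J * d₀) + 0 ≡ (J * d₀ + j * n) + (n + J * (d + c))
        pot-identity = solve-∀
      decide : Dec (n ≤ Ξ * ⟪ active s ⟫) → Stocked
      decide (yes big) = continue (add-gadget (active s) P good-a head len≤ big)
      decide (no ¬big) = stocked s flat≡ P good-a head len≤ (≰⇒> ¬big)

-- Inserting prescribed vertices

-- The error terms are at most n²/4A for the two `u` and n²/2A for the two `l`, so n²/4A of `T`
-- remains.
dense-pair-arith : ∀ n A T t u l .{{_ : NonZero n}} → n * n ≤ A * T → T ≤ t + ((n * u + n * u) + (l + l)) →
  4 * A * l ≤ n * n → 8 * A * u ≤ n → 0 < t
dense-pair-arith n A T t u l hT split hl hu = pos t (lin 0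
  (+-mono-≤ (+-mono-≤ (*-monoʳ-≤ 4 hT) (*-monoʳ-≤ (4 * A) split)) (+-mono-≤ (*-monoʳ-≤ 2 hl) (*-monoʳ-≤ n hu)))
  (identity n A T t u l))
  where
  identity : ∀ n A T t u l →
    n * n + ((4 * (A * T) + 4 * A * (t + ((n * u + n * u) + (l + l)))) + (2 * (n * n) + n * n)) + 0 ≡
    4 * A * t + ((4 * (n * n) + 4 * A * T) + (2 * (4 * A * l) + n * (8 * A * u)))
  identity = solve-∀
  pos : ∀ t → n * n ≤ 4 * A * t → 0 < t
  pos (suc _) _ = s≤s z≤n
  pos zero    h = contradiction (≤-trans h (≤-reflexive (*-zeroʳ (4 * A)))) (<⇒≱ (>-nonZero⁻¹ (n * n) {{m*n≢0 n n}}))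

module Inserting {n : ℕ} (H : 3Graph n) (D C K : ℕ) .{{_ : NonZero n}} .{{_ : NonZero D}}
  (K-large : 4 * ((D * C) * (D * C)) < K) (p q : Fin n) where
  open Link H
  open Extend H D C K K-large
  open Absorption H
  open Growth H D C K K-large p q

  module _ (A : ℕ) (v : V) (W : VSet n) (deg : n * n ≤ A * degree v) (room : 8 * A * ⟪ (λ x → not (W x)) ⟫ ≤ n) where

    poor : VSet n
    poor f = 4 * A * ⟪ N v f W ⟫ <ᵇ n

    target : V → V → Bool
    target f g = W f ∧ (W g ∧ (edge H v f g ∧ (not (poor f) ∧ not (poor g))))

    -- An ordered edge fg of the link of `v` is a target, or has an end outside `W`, or lies in `W`
    -- and has a poor end; the last kind is counted from its poor end.
    link-split : degree v ≤ Σᵥ (λ f → Σᵥ λ g → 𝟙 (target f g)) +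
      ((n * ⟪ (λ x → not (W x)) ⟫ + n * ⟪ (λ x → not (W x)) ⟫) +
       (Σᵥ (λ f → 𝟙 (poor f) * ⟪ N v f W ⟫) + Σᵥ (λ f → 𝟙 (poor f) * ⟪ N v f W ⟫)))
    link-split = ≤-trans (Σ-mono λ f → Σ-mono λ g → pointwise f g) (≤-reflexive total)
      where
      out : VSet n
      out x = not (W x)
      bool : ∀ wf wg e lf lg → 𝟙 e ≤ 𝟙 (wf ∧ (wg ∧ (e ∧ (not lf ∧ not lg)))) +
        ((𝟙 (not wf) + 𝟙 (not wg)) + (𝟙 lf * 𝟙 (wg ∧ e) + 𝟙 lg * 𝟙 (wf ∧ e)))
      bool _     _     false _     _     = z≤n
      bool false _     true  _     _     = s≤s z≤n
      bool true  false true  _     _     = s≤s z≤n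
      bool true  true  true  true  _     = s≤s z≤n
      bool true  true  true  false true  = s≤s z≤n
      bool true  true  true  false false = s≤s z≤n
      pointwise : ∀ f g → 𝟙 (edge H v f g) ≤ 𝟙 (target f g) +
        ((𝟙 (out f) + 𝟙 (out g)) + (𝟙 (poor f) * 𝟙 (N v f W g) + 𝟙 (poor g) * 𝟙 (N v g W f)))
      pointwise f g = subst (λ q → 𝟙 (edge H v f g) ≤ 𝟙 (target f g) +
        ((𝟙 (out f) + 𝟙 (out g)) + (𝟙 (poor f) * 𝟙 (N v f W g) + 𝟙 (poor g) * 𝟙 (W f ∧ q)))) (sym₂₃ H v f g)
        (bool (W f) (W g) (edge H v f g) (poor f) (poor g))
      poor-sum : Σᵥ (λ f → Σᵥ λ g → 𝟙 (poor f) * 𝟙 (N v f W g)) ≡ Σᵥ (λ f → 𝟙 (poor f) * ⟪ N v f W ⟫)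
      poor-sum = Σ-cong λ f → Σ-*ˡ (𝟙 (poor f)) _
      Σ²-+ : ∀ (f g : V → V → ℕ) → Σᵥ (λ x → Σᵥ λ y → f x y + g x y) ≡ Σᵥ (λ x → Σᵥ (f x)) + Σᵥ (λ x → Σᵥ (g x))
      Σ²-+ f g = trans (Σ-cong λ x → Σ-+ (f x) (g x)) (Σ-+ _ _)
      out-f : Σᵥ (λ (f : V) → Σᵥ λ (g : V) → 𝟙 (out f)) ≡ n * ⟪ out ⟫
      out-f = trans (Σ-cong λ f → Σ-const (𝟙 (out f))) (Σ-*ˡ n _)
      total : Σᵥ (λ f → Σᵥ λ g → 𝟙 (target f g) +
          ((𝟙 (out f) + 𝟙 (out g)) + (𝟙 (poor f) * 𝟙 (N v f W g) + 𝟙 (poor g) * 𝟙 (N v g W f)))) ≡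
        Σᵥ (λ f → Σᵥ λ g → 𝟙 (target f g)) + ((n * ⟪ out ⟫ + n * ⟪ out ⟫) +
          (Σᵥ (λ f → 𝟙 (poor f) * ⟪ N v f W ⟫) + Σᵥ (λ f → 𝟙 (poor f) * ⟪ N v f W ⟫)))
      total = trans (Σ²-+ _ _) (cong (Σᵥ (λ f → Σᵥ λ g → 𝟙 (target f g)) +_) (trans (Σ²-+ _ _) (cong₂ _+_
        (trans (Σ²-+ _ _) (cong₂ _+_ out-f (Σ-const ⟪ out ⟫)))
        (trans (Σ²-+ _ _) (cong₂ _+_ poor-sum (trans (Σ-swap _) poor-sum))))))

    poor-small : 4 * A * Σᵥ (λ f → 𝟙 (poor f) * ⟪ N v f W ⟫) ≤ n * n
    poor-small = ≤-trans (≤-reflexive (sym (Σ-*ˡ (4 * A) _))) (≤-trans (Σ-mono pointwise) (≤-reflexive (Σ-const n)))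
      where
      go : ∀ c m → (c ≡ true → 4 * A * m < n) → 4 * A * (𝟙 c * m) ≤ n
      go false m _ = ≤-trans (≤-reflexive (*-zeroʳ (4 * A))) z≤n
      go true  m h = ≤-trans (≤-reflexive (cong (4 * A *_) (*-identityˡ m))) (<⇒≤ (h refl))
      pointwise : ∀ f → 4 * A * (𝟙 (poor f) * ⟪ N v f W ⟫) ≤ n
      pointwise f = go (poor f) ⟪ N v f W ⟫ (<ᵇ-true _ n)

    opaque
      -- Both ends must be rich: from `g` one chooses h with vgh an edge, and at `f` the path has to
      -- continue beyond the pair `v`, `f`.
      rich-pair : ∃ λ f → ∃ λ g → W f ≡ true × W g ≡ true × E v f g × n ≤ 4 * A * ⟪ N v f W ⟫ × n ≤ 4 * A * ⟪ N v g W ⟫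
      rich-pair =
        let f , f-pos = Σ-pos (λ f → Σᵥ λ g → 𝟙 (target f g)) (dense-pair-arith n A (degree v) _ _ _ deg link-split poor-small room)
            g , g-pos = Σ-pos (λ g → 𝟙 (target f g)) f-pos
            Wf , rest = ∧-true {W f} (𝟙-pos {target f g} g-pos)
            Wg , rest′ = ∧-true {W g} rest
            vfg , rich = ∧-true {edge H v f g} rest′
            rich-f , rich-g = ∧-true {not (poor f)} rich
        in f , g , Wf , Wg , vfg , <ᵇ-false _ n (not-true rich-f) , <ᵇ-false _ n (not-true rich-g)

  module Insert (A Hc : ℕ) (F : VSet n) (not-F : ∀ x → F x ≡ false → Good D K x)
    (4D≤Hc : 2 * (2 * D) ≤ Hc) (8A≤Hc : 2 * (4 * A) ≤ Hc) (2Hc≤C : 2 * Hc ≤ C) (n-large : 2 * Hc * 7 ≤ n)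
    (deg : ∀ v → n * n ≤ A * degree v) where

    Head : V → V → List V → Set
    Head a b r = n ≤ Hc * ⟪ N a b (avail F (a ∷ b ∷ r)) ⟫

    record Inserted (v : V) (L : List V) : Set where
      constructor inserted
      field
        {f g h z y x} : V
        path : Path f v (g ∷ h ∷ z ∷ y ∷ x ∷ L)
        good : Good D K f
        head : Head f v (g ∷ h ∷ z ∷ y ∷ x ∷ L)

    big-shrink : ∀ m x y → m ≤ 7 → n ≤ Hc * x → x ≤ y + m → n ≤ 2 * Hc * y
    big-shrink m x y m≤7 h h′ = shrink n Hc m x y h h′ (≤-trans (*-monoʳ-≤ (2 * Hc) m≤7) n-large)

    2≤Hc : 2 ≤ Hc
    2≤Hc = ≤-trans (*-monoʳ-≤ 2 (>-nonZero⁻¹ (2 * D) {{m*n≢0 2 D}})) 4D≤Hc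

    -- The path ending in b a is prolonged by the seven vertices x y z h g v f. The rich pair f, g
    -- is fixed first, then h with many z such that ghz is an edge, and finally `connect` joins `a`
    -- to h, so `v` itself need not be good.
    insert : ∀ {a b r} v → Path a b r → Good D K a → Head a b r → F v ≡ true → occ v (a ∷ b ∷ r) ≡ 0 →
      8 * A * (⟪ F ⟫ + length (a ∷ b ∷ r)) ≤ n → 2 * (⟪ F ⟫ + length (a ∷ b ∷ r)) ≤ n → Inserted v (a ∷ b ∷ r)
    insert {a} {b} {r} v P good-a head Fv v∉L room room₂ = go-pair (rich-pair A v W (deg v) room′)
      where
      L : List V
      L = a ∷ b ∷ r
      W : VSet n
      W = avail F L
      out : VSet n
      out x = not (W x)
      out≤ : ⟪ out ⟫ ≤ ⟪ F ⟫ + length L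
      out≤ = ≤-trans (card-avail F L out (λ _ → false) λ x o w → contradiction (trans (sym w) (not-true o)) λ ())
        (≤-reflexive (cong (_+ (⟪ F ⟫ + length L)) Σ-zero))
      room′ : 8 * A * ⟪ out ⟫ ≤ n
      room′ = ≤-trans (*-monoʳ-≤ (8 * A) out≤) room
      n≤2W : n ≤ 2 * ⟪ W ⟫
      n≤2W = half n ⟪ W ⟫ (⟪ F ⟫ + length L) (card-avail-≥ F L) room₂
      4A≤Hc : 4 * A ≤ Hc
      4A≤Hc = ≤-trans (m≤n*m (4 * A) 2) 8A≤Hc
      bigW : n ≤ Hc * ⟪ W ⟫
      bigW = ≤-trans n≤2W (*-monoˡ-≤ ⟪ W ⟫ 2≤Hc)
      Hc≤C : Hc ≤ C
      Hc≤C = ≤-trans (m≤n*m Hc 2) 2Hc≤C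

      module _ (f g : V) (Wf : W f ≡ true) (Wg : W g ≡ true) (vfg : E v f g)
               (rich-f : n ≤ 4 * A * ⟪ N v f W ⟫) (rich-g : n ≤ 4 * A * ⟪ N v g W ⟫) where

        good-W : ∀ {x} → W x ≡ true → Good D K x
        good-W {x} Wx = not-F x (proj₁ (avail-elim F L x Wx))

        candidates : VSet n
        candidates = N v g W ∖ f

        big-candidates : Big candidates
        big-candidates = big-≤ candidates 2Hc≤C (big-shrink 1 ⟪ N v g W ⟫ ⟪ candidates ⟫ (s≤s z≤n)
          (≤-trans rich-g (*-monoˡ-≤ ⟪ N v g W ⟫ 4A≤Hc))
          (≤-reflexive (trans (sym (card-∖ (N v g W) f (N-intro W Wf (E₂₃ vfg)))) (+-comm 1 _))))

        module _ (h : V) (h∈ : candidates h ≡ true) (deg-h : ⟪ W ⟫ ≤ 2 * D * ⟪ N g h W ⟫) where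

          h∈N : N v g W h ≡ true
          h∈N = proj₁ (∧-true {N v g W h} h∈)
          Wh : W h ≡ true
          Wh = proj₁ (N-elim v g W {h} h∈N)
          vgh : E v g h
          vgh = proj₂ (N-elim v g W {h} h∈N)
          h≢f : h ≢ f
          h≢f refl = contradiction (trans (sym (==-refl h)) (not-true (proj₂ (∧-true {N v g W h} h∈)))) λ ()

          -- The vertices f, g, h are reserved before the connection is made, so that x, y, z avoid
          -- them.
          L₁ : List V
          L₁ = f ∷ g ∷ h ∷ L
          W₁ : VSet n
          W₁ = avail F L₁

          bigX : Big (N a b W₁)
          bigX = big-≤ (N a b W₁) 2Hc≤C (big-shrink 3 ⟪ N a b W ⟫ ⟪ N a b W₁ ⟫ (s≤s (s≤s (s≤s z≤n))) head
            (N-without F (f ∷ g ∷ h ∷ []) L a b))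
          bigZ : Big (N g h W₁)
          bigZ = big-≤ (N g h W₁) 2Hc≤C (big-shrink 3 ⟪ N g h W ⟫ ⟪ N g h W₁ ⟫ (s≤s (s≤s (s≤s z≤n)))
            (≤-trans (chain 2 ⟪ W ⟫ ⟪ N g h W ⟫ n≤2W deg-h) (*-monoˡ-≤ ⟪ N g h W ⟫ 4D≤Hc))
            (N-without F (f ∷ g ∷ h ∷ []) L g h))
          bigY : Big W₁
          bigY = big-≤ W₁ 2Hc≤C (big-shrink 3 ⟪ W ⟫ ⟪ W₁ ⟫ (s≤s (s≤s (s≤s z≤n))) bigW
            (card-without (f ∷ g ∷ h ∷ []) W W₁ λ x Wx x∉ → avail-++ F (f ∷ g ∷ h ∷ []) L x Wx x∉))

          finish : (∃ λ x → ∃ λ y → ∃ λ z → N a b W₁ x ≡ true × W₁ y ≡ true × N g h W₁ z ≡ true × E a x y × E x y z × E h z y) →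
            Inserted v L
          finish (x , y , z , x∈ , W₁y , z∈ , axy , xyz , hzy) = inserted path₇ (good-W Wf) new-head
            where
            outside : ∀ {u} → W₁ u ≡ true → occ u L₁ ≡ 0
            outside {u} W₁u = proj₂ (avail-elim F L₁ u W₁u)
            F-false : ∀ {u} → W₁ u ≡ true → F u ≡ false
            F-false {u} W₁u = proj₁ (avail-elim F L₁ u W₁u)
            W∉L : ∀ {u} → W u ≡ true → occ u L ≡ 0
            W∉L {u} Wu = proj₂ (avail-elim F L u Wu)
            W₁x : W₁ x ≡ true
            W₁x = proj₁ (N-elim a b W₁ {x} x∈)
            W₁z : W₁ z ≡ true
            W₁z = proj₁ (N-elim g h W₁ {z} z∈)
            abx : E a b x
            abx = proj₂ (N-elim a b W₁ {x} x∈)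
            ghz : E g h z
            ghz = proj₂ (N-elim g h W₁ {z} z∈)
            ∉L : ∀ {u} → W₁ u ≡ true → occ u L ≡ 0
            ∉L {u} W₁u = fresh-drop u (f ∷ g ∷ h ∷ []) L (outside W₁u)
            ≢f : ∀ {u} → W₁ u ≡ true → f ≢ u
            ≢f {u} W₁u = fresh-head u f (g ∷ h ∷ L) (outside W₁u) ∘ sym
            ≢g : ∀ {u} → W₁ u ≡ true → g ≢ u
            ≢g {u} W₁u = fresh-head u g (h ∷ L) (fresh-drop u (f ∷ []) (g ∷ h ∷ L) (outside W₁u)) ∘ sym
            ≢h : ∀ {u} → W₁ u ≡ true → h ≢ u
            ≢h {u} W₁u = fresh-head u h L (fresh-drop u (f ∷ g ∷ []) (h ∷ L) (outside W₁u)) ∘ sym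
            ≢v : ∀ {u} → F u ≡ false → v ≢ u
            ≢v Fu refl = contradiction (trans (sym Fv) Fu) λ ()
            fresh-xyz : ∀ {u} → u ≢ z → u ≢ y → u ≢ x → occ u L ≡ 0 → occ u (z ∷ y ∷ x ∷ L) ≡ 0
            fresh-xyz u≢z u≢y u≢x u∉ = fresh-∷ {L = y ∷ x ∷ L} u≢z (fresh-∷ {L = x ∷ L} u≢y (fresh-∷ {L = L} u≢x u∉))
            path₁ : Path x a (b ∷ r)
            path₁ = path-∷ P (E₁₂ (E₂₃ abx)) (∉L W₁x)
            path₂ : Path y x L
            path₂ = path-∷ path₁ (E₁₂ (E₂₃ (E₁₂ axy))) (fresh-∷ {L = L} (E⇒≢₁₂ xyz ∘ sym) (∉L W₁y))
            path₃ : Path z y (x ∷ L)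
            path₃ = path-∷ path₂ (E₁₂ (E₂₃ (E₁₂ xyz)))
              (fresh-∷ {L = x ∷ L} (E⇒≢₂₃ xyz ∘ sym) (fresh-∷ {L = L} (E⇒≢₁₃ xyz ∘ sym) (∉L W₁z)))
            path₄ : Path h z (y ∷ x ∷ L)
            path₄ = path-∷ path₃ hzy (fresh-xyz (≢h W₁z) (≢h W₁y) (≢h W₁x) (W∉L Wh))
            path₅ : Path g h (z ∷ y ∷ x ∷ L)
            path₅ = path-∷ path₄ ghz (fresh-∷ {L = z ∷ y ∷ x ∷ L} (E⇒≢₁₂ ghz) (fresh-xyz (≢g W₁z) (≢g W₁y) (≢g W₁x) (W∉L Wg)))
            path₆ : Path v g (h ∷ z ∷ y ∷ x ∷ L)
            path₆ = path-∷ path₅ vgh (fresh-∷ {L = h ∷ z ∷ y ∷ x ∷ L} (E⇒≢₁₂ vgh) (fresh-∷ {L = z ∷ y ∷ x ∷ L} (E⇒≢₁₃ vgh)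
              (fresh-xyz (≢v (F-false W₁z)) (≢v (F-false W₁y)) (≢v (F-false W₁x)) v∉L)))
            path₇ : Path f v (g ∷ h ∷ z ∷ y ∷ x ∷ L)
            path₇ = path-∷ path₆ (E₁₂ vfg) (fresh-∷ {L = g ∷ h ∷ z ∷ y ∷ x ∷ L} (E⇒≢₁₂ vfg ∘ sym)
              (fresh-∷ {L = h ∷ z ∷ y ∷ x ∷ L} (E⇒≢₂₃ vfg) (fresh-∷ {L = z ∷ y ∷ x ∷ L} (h≢f ∘ sym)
                (fresh-xyz (≢f W₁z) (≢f W₁y) (≢f W₁x) (W∉L Wf)))))
            added : List V
            added = f ∷ v ∷ g ∷ h ∷ z ∷ y ∷ x ∷ []
            new-head : Head f v (g ∷ h ∷ z ∷ y ∷ x ∷ L)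
            -- The continuations of the pair f, v come from `rich-f`: the seven new vertices reduce
            -- n/4A to no less than n/8A.
            new-head = ≤-trans (shrink n (4 * A) 7 ⟪ N v f W ⟫ ⟪ N f v (avail F (added ++ L)) ⟫ rich-f
              (≤-trans (N-swap v f W) (N-without F added L f v))
              (≤-trans (*-monoˡ-≤ 7 (≤-trans 8A≤Hc (m≤n*m Hc 2))) n-large)) (*-monoˡ-≤ ⟪ N f v (avail F (added ++ L)) ⟫ 8A≤Hc)

          go-connect : Inserted v L
          go-connect = finish (connect good-a (good-W Wh) (N a b W₁) W₁ (N g h W₁) bigX bigY bigZ
            λ y W₁y → not-F y (proj₁ (avail-elim F L₁ y W₁y)))

        go-h : (∃ λ h → candidates h ≡ true × ⟪ W ⟫ ≤ 2 * D * ⟪ N g h W ⟫ × ⟪ W ⟫ ≤ 2 * D * ⟪ N g h W ⟫) → Inserted v L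
        go-h (h , h∈ , deg-h , _) = go-connect h h∈ deg-h

        choose-h : Inserted v L
        choose-h = go-h (pick (good-W Wg) (good-W Wg) candidates W W big-candidates (big-≤ W Hc≤C bigW) (big-≤ W Hc≤C bigW))

      go-pair : (∃ λ f → ∃ λ g → W f ≡ true × W g ≡ true × E v f g × n ≤ 4 * A * ⟪ N v f W ⟫ × n ≤ 4 * A * ⟪ N v g W ⟫) →
        Inserted v L
      go-pair (f , g , Wf , Wg , vfg , rich-f , rich-g) = choose-h f g Wf Wg vfg rich-f rich-g

    missing : List V → VSet n
    missing L x = F x ∧ (occ x L ≡ᵇ 0)

    missing-intro : ∀ L x → F x ≡ true → occ x L ≡ 0 → missing L x ≡ true
    missing-intro L x Fx x∉ rewrite Fx | x∉ = refl

    missing-elim : ∀ L x → missing L x ≡ true → F x ≡ true × occ x L ≡ 0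
    missing-elim L x x∈ = let Fx , x∉ = ∧-true {F x} x∈ in Fx , ≡ᵇ⇒≡ (occ x L) 0 (subst T (sym x∉) tt)

    record Completed (k u : ℕ) : Set where
      constructor completed
      field
        {a b}     : V
        {r}       : List V
        segs      : List Seg
        flat≡     : flat segs ≡ a ∷ b ∷ r
        path      : Path a b r
        good      : Good D K a
        head      : Head a b r
        covers    : ∀ x → F x ≡ true → occ x (a ∷ b ∷ r) ≢ 0
        stock     : ∀ x → F x ≡ false → k ≤ cnt x segs
        len       : length (a ∷ b ∷ r) ≤ u

    -- A round covers one missing vertex of `F` at the price of seven path vertices, so `u` bounds
    -- the final length and room is checked for `u` once. The new vertices enter as `pt`, which
    -- leaves all gadget counts unchanged.
    insert-all : ∀ k u m s {a b r} → flat s ≡ a ∷ b ∷ r → Path a b r → Good D K a → Head a b r →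
      (∀ x → F x ≡ false → k ≤ cnt x s) → ⟪ missing (a ∷ b ∷ r) ⟫ ≤ m →
      length (a ∷ b ∷ r) + 7 * m ≤ u → 8 * A * (⟪ F ⟫ + u) ≤ n → 2 * (⟪ F ⟫ + u) ≤ n →
      Completed k u
    insert-all k u m s {a} {b} {r} flat≡ P good-a head stock missing≤ len room room₂ = decide m missing≤ len (⟪ missing L ⟫ ≟ 0)
      where
      L : List V
      L = a ∷ b ∷ r
      done : ⟪ missing L ⟫ ≡ 0 → Completed k u
      done none = completed s flat≡ P good-a head
        (λ x Fx x∉ → contradiction (trans (sym (missing-intro L x Fx x∉)) (card-empty (missing L) none x)) λ ())
        stock (≤-trans (m≤m+n (length L) (7 * m)) len)
      decide : ∀ m → ⟪ missing L ⟫ ≤ m → length L + 7 * m ≤ u → Dec (⟪ missing L ⟫ ≡ 0) → Completed k u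
      decide _       _        _    (yes none) = done none
      decide zero    missing≤ _    (no some)  = contradiction (n≤0⇒n≡0 missing≤) some
      decide (suc m) missing≤ len′ (no some)  = next (card-witness (missing L) (n≢0⇒n>0 some))
        where
        len≤u : ⟪ F ⟫ + length L ≤ ⟪ F ⟫ + u
        len≤u = +-monoʳ-≤ ⟪ F ⟫ (≤-trans (m≤m+n (length L) (7 * suc m)) len′)
        continue : ∀ v → missing L v ≡ true → Inserted v L → Completed k u
        continue v v∈ (inserted {f} {g} {h} {z} {y} {x} P′ good′ head′) =
          insert-all k u m (pt f ∷ pt v ∷ pt g ∷ pt h ∷ pt z ∷ pt y ∷ pt x ∷ s)
            (cong (λ M → f ∷ v ∷ g ∷ h ∷ z ∷ y ∷ x ∷ M) flat≡) P′ good′ head′ stock missing′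
            (≤-trans (≤-reflexive (identity (length L) m)) len′) room room₂
          where
          identity : ∀ l m → 7 + l + 7 * m ≡ l + 7 * suc m
          identity = solve-∀
          L′ : List V
          L′ = f ∷ v ∷ g ∷ h ∷ z ∷ y ∷ x ∷ L
          missing′ : ⟪ missing L′ ⟫ ≤ m
          missing′ = s≤s⁻¹ (≤-trans (s≤s (card-mono (missing L′) (missing L ∖ v) sub))
            (≤-trans (≤-reflexive (card-∖ (missing L) v v∈)) missing≤))
            where
            sub : ∀ u → missing L′ u ≡ true → (missing L ∖ v) u ≡ true
            sub u u∈ =
              let Fu , u∉ = missing-elim L′ u u∈
                  added = f ∷ v ∷ g ∷ h ∷ z ∷ y ∷ x ∷ []
                  rest = g ∷ h ∷ z ∷ y ∷ x ∷ L
              in ∧-intro (missing-intro L u Fu (fresh-drop u added L u∉))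
                   (cong not (==-≢ (fresh-head u v rest (fresh-drop u (f ∷ []) (v ∷ rest) u∉))))
        next : (∃ λ v → missing L v ≡ true) → Completed k u
        next (v , v∈) = continue v v∈ (insert v P good-a head (proj₁ (missing-elim L v v∈)) (proj₂ (missing-elim L v v∈))
          (≤-trans (*-monoʳ-≤ (8 * A) len≤u) room) (≤-trans (*-monoʳ-≤ 2 len≤u) room₂))

-- Covering almost everything and closing the cycle

module Closing {n : ℕ} (H : 3Graph n) (D C K : ℕ) .{{_ : NonZero n}} .{{_ : NonZero D}}
  (K-large : 4 * ((D * C) * (D * C)) < K) (p q : Fin n) where
  open Link H
  open Extend H D C K K-large
  open Absorption H
  open Growth H D C K K-large p q

  module _ (r k c : ℕ) (R : VSet n) (∣R∣ : ⟪ R ⟫ ≡ r) (R⊆ : ∀ v → R v ≡ true → E p q v) (good-q : Good D K q)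
    (n≤cr : n ≤ c * r) (c≤C : c * (2 * D) ≤ C) (2r≤k : r + r ≤ k) where

    big-r : ∀ X → r ≤ 2 * D * ⟪ X ⟫ → Big X
    big-r X h = big-≤ X c≤C (chain c r ⟪ X ⟫ n≤cr h)

    big-r′ : ∀ X → r ≤ ⟪ X ⟫ → Big X
    big-r′ X h = big-r X (≤-trans h (m≤n*m ⟪ X ⟫ (2 * D) {{m*n≢0 2 D}}))

    avail-∷ : ∀ F (x : V) L v → avail F (x ∷ L) v ≡ (avail F L ∖ x) v
    avail-∷ F x L v with v == x
    ... | true  = trans (∧-zeroʳ (not (F v))) (sym (∧-zeroʳ _))
    ... | false = sym (∧-identityʳ _)

    close : ∀ m s {a b t} → flat s ≡ a ∷ b ∷ t → Path a b t → Good D K a →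
      ⟪ avail R (a ∷ b ∷ t) ⟫ ≡ m + r → r ≤ 2 * D * ⟪ N a b (avail R (a ∷ b ∷ t)) ⟫ →
      (∀ v → occ v (a ∷ b ∷ t) ≡ 0 → Good D K v) → (∀ v → occ v (a ∷ b ∷ t) ≡ 0 → k ≤ cnt v s) →
      (∀ v → R v ≡ true → occ v (a ∷ b ∷ t) ≡ 0) → HamiltonList
    close zero s {a} {b} {t} flat≡ P good-a card head fresh-good fresh-cnt R-fresh =
      -- The last connecting vertex z is taken from `R`, which makes pqz an edge; `connect` towards
      -- `q` supplies qzy, and both are needed at the seam.
      finish (connect good-a good-q (N a b W) W R (big-r (N a b W) head) (big-r′ W (≤-reflexive (sym card)))
        (big-r′ R (≤-reflexive (sym ∣R∣))) λ y Wy → fresh-good y (W∉L Wy))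
      where
      L : List V
      L = a ∷ b ∷ t
      W : VSet n
      W = avail R L
      W∉L : ∀ {u} → W u ≡ true → occ u L ≡ 0
      W∉L {u} Wu = proj₂ (avail-elim R L u Wu)
      finish : (∃ λ x → ∃ λ y → ∃ λ z → N a b W x ≡ true × W y ≡ true × R z ≡ true × E a x y × E x y z × E q z y) → HamiltonList
      finish (x , y , z , x∈ , Wy , Rz , axy , xyz , qzy) =
        z , y , absorb-all ⟪ unused L′ ⟫ z y (pt x ∷ s) (cong (λ l → ⟪ unused (z ∷ y ∷ x ∷ l) ⟫) flat≡)
          (subst (λ l → Simple (z ∷ y ∷ x ∷ l)) (sym flat≡) (Path.simple path₃))
          (subst (λ l → TightFrom z y (x ∷ l ++ z ∷ y ∷ [])) (sym flat≡) (Path.tight path₃ (z ∷ y ∷ []) (R⊆ z Rz , qzy , tt)))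
          λ v v∉ → ≤-trans unused≤k (fresh-cnt v (subst (λ l → occ v l ≡ 0) flat≡
            (fresh-drop v (z ∷ y ∷ x ∷ []) (flat s) v∉)))
        where
        L′ : List V
        L′ = z ∷ y ∷ x ∷ L
        Wx : W x ≡ true
        Wx = proj₁ (N-elim a b W {x} x∈)
        path₁ : Path x a (b ∷ t)
        path₁ = path-∷ P (E₁₂ (E₂₃ (proj₂ (N-elim a b W {x} x∈)))) (W∉L Wx)
        path₂ : Path y x L
        path₂ = path-∷ path₁ (E₁₂ (E₂₃ (E₁₂ axy))) (fresh-∷ {L = L} (E⇒≢₁₂ xyz ∘ sym) (W∉L Wy))
        path₃ : Path z y (x ∷ L)
        path₃ = path-∷ path₂ (E₁₂ (E₂₃ (E₁₂ xyz)))
          (fresh-∷ {L = x ∷ L} (E⇒≢₂₃ xyz ∘ sym) (fresh-∷ {L = L} (E⇒≢₁₃ xyz ∘ sym) (R-fresh z Rz)))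
        covered : ∀ v → unused L′ v ≡ true → W v ≡ true ⊎ R v ≡ true
        covered v v∈ = go (R v) refl
          where
          v∉L : occ v L ≡ 0
          v∉L = fresh-drop v (z ∷ y ∷ x ∷ []) L (proj₂ (avail-elim (λ _ → false) L′ v v∈))
          go : ∀ β → R v ≡ β → W v ≡ true ⊎ R v ≡ true
          go true  Rv = inj₂ Rv
          go false Rv = inj₁ (avail-intro R L v Rv v∉L)
        unused≤k : ⟪ unused L′ ⟫ ≤ k
        unused≤k = ≤-trans (card-cover (unused L′) W R covered) (≤-trans (≤-reflexive (cong₂ _+_ card ∣R∣)) 2r≤k)
    close (suc m) s {a} {b} {t} flat≡ P good-a card head fresh-good fresh-cnt R-fresh =
      continue (extend P good-a R R W (big-r (N a b W) head) bigW bigW)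
      where
      L : List V
      L = a ∷ b ∷ t
      W : VSet n
      W = avail R L
      r≤W : r ≤ ⟪ W ⟫
      r≤W = ≤-trans (m≤n+m r (suc m)) (≤-reflexive (sym card))
      bigW : Big W
      bigW = big-r′ W r≤W
      continue : Extension a b t R R W → HamiltonList
      continue (extension x x∈ P′ onward _) = close m (pt x ∷ s) (cong (x ∷_) flat≡) P′ (fresh-good x x∉)
        (suc-injective (trans (cong suc (Σ-cong λ v → cong 𝟙 (avail-∷ R x L v))) (trans (card-∖ W x x∈) card)))
        (≤-trans r≤W onward)
        (λ v v∉ → fresh-good v (fresh-drop v (x ∷ []) L v∉))
        (λ v v∉ → fresh-cnt v (fresh-drop v (x ∷ []) L v∉))
        λ v Rv → fresh-∷ {L = L} (R≢x v Rv) (R-fresh v Rv)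
        where
        x∉ : occ x L ≡ 0
        x∉ = proj₂ (avail-elim R L x x∈)
        R≢x : ∀ v → R v ≡ true → v ≢ x
        R≢x v Rv refl = contradiction (trans (sym Rv) (proj₁ (avail-elim R L x x∈))) λ ()

-- Putting the phases together

-- The budget behind the factors 32 and 12: 8f is at most n/2Q, while 8Jr and 3 are at most n/4Q
-- each.
used-bound : ∀ n Q J r β σ f → f ≤ β + σ → 32 * Q * β ≤ n → 32 * Q * σ ≤ n → 32 * Q * J * r ≤ n → 12 * Q ≤ n →
  Q * (f + (3 + 4 * (J * (r + r)) + 7 * f)) ≤ n
used-bound n Q J r β σ f hf hβ hσ hr hQ = *-cancelˡ-≤ 4 (lin 0
  (+-mono-≤ (*-monoʳ-≤ (32 * Q) hf) (+-mono-≤ (+-mono-≤ hβ hσ) (+-mono-≤ hr hQ))) (identity n Q J r β σ f))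
  where
  identity : ∀ n Q J r β σ f →
    4 * (Q * (f + (3 + 4 * (J * (r + r)) + 7 * f))) + (32 * Q * (β + σ) + ((n + n) + (n + n))) + 0 ≡
    4 * n + (32 * Q * f + ((32 * Q * β + 32 * Q * σ) + (32 * Q * J * r + 12 * Q)))
  identity = solve-∀

module Assembly {n : ℕ} (H : 3Graph n) (A D Q Hc J C K r c : ℕ) .{{_ : NonZero n}} .{{_ : NonZero D}} .{{_ : NonZero Hc}}
  (K-large : 4 * ((D * C) * (D * C)) < K)
  (8A≤Q : 8 * A ≤ Q) (8D≤Q : 8 * D ≤ Q) (4D≤Hc : 2 * (2 * D) ≤ Hc) (8A≤Hc : 2 * (4 * A) ≤ Hc) (2Hc≤C : 2 * Hc ≤ C)
  (J-def : J ≡ 32 * Q * (2 * D) * (2 * D) * (2 * D)) (J≤C : J ≤ C) (c≤C : c * (2 * D) ≤ C) (n≤cr : n ≤ c * r)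
  (r-J : 32 * Q * J * r ≤ n) (r-Hc : 2 * Hc * r ≤ n) (r-D : 8 * D * r ≤ n) (n-Q : 12 * Q ≤ n) (n-Hc : 2 * Hc * 7 ≤ n)
  (bad : VSet n) (not-bad : ∀ v → bad v ≡ false → Link.Good H D K v) (few-bad : 32 * Q * ⟪ bad ⟫ ≤ n)
  where
  open Link H
  open Extend H D C K K-large
  open Absorption H

  -- Up to r reservoir vertices and r others remain when the cycle closes, and each of them uses up
  -- a gadget.
  k : ℕ
  k = r + r

  4≤Q : 4 ≤ Q
  4≤Q = ≤-trans (m≤m*n 4 D) (≤-trans (*-monoˡ-≤ D (s≤s (s≤s (s≤s (s≤s (z≤n {4})))))) 8D≤Q)

  2≤Hc : 2 ≤ Hc
  2≤Hc = ≤-trans (*-monoʳ-≤ 2 (>-nonZero⁻¹ (2 * D) {{m*n≢0 2 D}})) 4D≤Hc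

  Hc≤C : Hc ≤ C
  Hc≤C = ≤-trans (m≤n*m Hc 2) 2Hc≤C

  room : 2 * (⟪ bad ⟫ + (6 + 4 * (J * k))) ≤ n
  room = ≤-trans (regroup ⟪ bad ⟫ (4 * (J * k)))
    (≤-trans (*-monoˡ-≤ _ 4≤Q) (used-bound n Q J r ⟪ bad ⟫ 0 ⟪ bad ⟫ (m≤m+n ⟪ bad ⟫ 0) few-bad
      (≤-trans (≤-reflexive (*-zeroʳ (32 * Q))) z≤n) r-J n-Q))
    where
    regroup : ∀ β t → 2 * (β + (6 + t)) ≤ 4 * (β + (3 + t + 7 * β))
    regroup β t = lin {L = 0} {R = 0} (30 * β + 2 * t) ≤-refl (identity β t)
      where
      identity : ∀ β t → 2 * (β + (6 + t)) + 0 + (30 * β + 2 * t) ≡ 4 * (β + (3 + t + 7 * β)) + 0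
      identity = solve-∀

  bad-half : ∀ L → length L ≤ 6 → n ≤ 2 * ⟪ avail bad L ⟫
  bad-half L len = half n ⟪ avail bad L ⟫ (⟪ bad ⟫ + length L) (card-avail-≥ bad L)
    (≤-trans (*-monoʳ-≤ 2 (+-monoʳ-≤ ⟪ bad ⟫ (≤-trans len (m≤m+n 6 _)))) room)

  -- The large common neighbourhood of `p` and `q` serves twice: the path starts into it, and the
  -- reservoir is later cut out of it.
  module FromPair (p q : Fin n) (good-p : Good D K p) (good-q : Good D K q) (p≢q : p ≢ q)
    (tail : n ≤ 2 * (2 * D) * ⟪ N q p (avail bad []) ⟫) where
    open Growth H D C K K-large p q
    open Absorbers Hc (32 * Q) J k bad not-bad J-def J≤C Hc≤C 4D≤Hc room
    open Inserting H D C K K-large p q using (module Insert)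
    open Closing H D C K K-large p q

    start : Path p q []
    start = mkPath simple λ _ t → t
      where
      simple : Simple (p ∷ q ∷ [])
      simple v with v Fin.≟ p | v Fin.≟ q
      ... | yes refl | yes eq = contradiction eq p≢q
      ... | yes _    | no _   = ≤-refl
      ... | no _     | yes _  = ≤-refl
      ... | no _     | no _   = z≤n

    start-head : Head p q []
    start-head = ≤-trans tail (*-mono-≤ 4D≤Hc (card-mono _ _ λ v v∈ →
      let v∈G , qpv = N-elim q p (avail bad []) v∈
      in N-intro (avail bad (p ∷ q ∷ [])) (avail-++ bad (p ∷ q ∷ []) [] v v∈G
           (fresh-∷ {L = q ∷ []} (E⇒≢₂₃ qpv ∘ sym) (fresh-∷ {L = []} (E⇒≢₁₃ qpv ∘ sym) refl))) (E₁₂ qpv)))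

    everything : VSet n
    everything _ = true

    tail-all : n ≤ 2 * (2 * D) * ⟪ N p q everything ⟫
    tail-all = ≤-trans tail (*-monoʳ-≤ (2 * (2 * D)) (card-mono _ _ λ v v∈ →
      N-intro everything refl (E₁₂ (proj₂ (N-elim q p (avail bad []) v∈)))))

    stocked-path : Stocked
    stocked-path = stock (suc (J * k)) 0 (pt p ∷ pt q ∷ []) refl start good-p start-head (+-identityʳ _) refl
      (≤-trans (≤-reflexive (+-identityʳ _)) (≤-trans (*-monoʳ-≤ J (≤-trans (Σ-mono λ v → ≤-refl) (≤-reflexive (Σ-const k))))
        (≤-reflexive (identity J n k))))
      where
      identity : ∀ J n k → J * (n * k) ≡ J * k * n
      identity = solve-∀

    finish : (∀ v → n * n ≤ A * degree v) → Stocked → HamiltonList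
    finish deg (stocked {a₀} {b₀} {r₀} s₀ flat₀ P₀ good₀ head₀ len₀ few₀) =
      -- One more vertex is spent on passing from heads that avoid `bad` to heads that avoid `F`;
      -- this accounts for the 3 in `u` where the stocked path has 2.
      begin-insertion (extend P₀ good₀ bad F (avail F L₀) (big-≤ _ Hc≤C head₀) bigW bigW)
      where
      L₀ : List V
      L₀ = a₀ ∷ b₀ ∷ r₀
      F : VSet n
      F v = bad v ∨ active s₀ v
      ∨-split : ∀ x y → x ∨ y ≡ true → x ≡ true ⊎ y ≡ true
      ∨-split true  _ _ = inj₁ refl
      ∨-split false _ h = inj₂ h
      ∨-false : ∀ x y → x ∨ y ≡ false → x ≡ false × y ≡ false
      ∨-false false _ h = refl , h
      f u : ℕ
      f = ⟪ F ⟫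
      u = 3 + 4 * (J * k) + 7 * f
      f≤ : f ≤ ⟪ bad ⟫ + ⟪ active s₀ ⟫
      f≤ = card-cover F bad (active s₀) λ v → ∨-split (bad v) (active s₀ v)
      Q-room : Q * (f + u) ≤ n
      Q-room = used-bound n Q J r ⟪ bad ⟫ ⟪ active s₀ ⟫ f f≤ few-bad (<⇒≤ few₀) r-J n-Q
      2-room : 2 * (f + u) ≤ n
      2-room = ≤-trans (*-monoˡ-≤ (f + u) (≤-trans (s≤s (s≤s z≤n)) 4≤Q)) Q-room
      len₁ : suc (length L₀) + 7 * f ≤ u
      len₁ = +-monoˡ-≤ (7 * f) (s≤s len₀)
      n≤2W : n ≤ 2 * ⟪ avail F L₀ ⟫
      n≤2W = half n ⟪ avail F L₀ ⟫ (f + length L₀) (card-avail-≥ F L₀)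
        (≤-trans (*-monoʳ-≤ 2 (+-monoʳ-≤ f (≤-trans (≤-trans (n≤1+n _) (m≤m+n _ (7 * f))) len₁))) 2-room)
      bigW : Big (avail F L₀)
      bigW = big-≤ (avail F L₀) (≤-trans 2≤Hc Hc≤C) n≤2W
      not-F : ∀ x → F x ≡ false → Good D K x
      not-F x Fx = not-bad x (proj₁ (∨-false (bad x) (active s₀ x) Fx))
      open Insert A Hc F not-F 4D≤Hc 8A≤Hc 2Hc≤C n-Hc deg using (Completed; completed; insert-all; missing)

      close-up : Completed k u → HamiltonList
      close-up (completed {a} {b} {t} s flat≡ P good-a head covers stock len) = reserve
        (subset-of-size (⟪ N p q W ⟫ ∸ r) r (N p q W) (sym (m∸n+n≡m r≤tail)))
        where
        L : List V
        L = a ∷ b ∷ t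
        W : VSet n
        W = avail F L
        -- Of at least n/4D common neighbours of `p` and `q` at most n/8D have been spent, and r is
        -- at most n/8D.
        r≤tail : r ≤ ⟪ N p q W ⟫
        r≤tail = *-cancelˡ-≤ (8 * D) {{m*n≢0 8 D}} (≤-trans r-D (≤-trans
          (shrink n (2 * (2 * D)) (f + length L) ⟪ N p q everything ⟫ ⟪ N p q W ⟫ tail-all
            (card-avail F L (N p q everything) (N p q W) λ v v∈ v∈W → N-intro W v∈W (proj₂ (N-elim p q everything {v} v∈)))
            (≤-trans (≤-reflexive (cong (_* (f + length L)) (eight D)))
              (≤-trans (*-mono-≤ 8D≤Q (+-monoʳ-≤ f len)) Q-room)))
          (≤-reflexive (cong (_* ⟪ N p q W ⟫) (eight D)))))
          where
          eight : ∀ D → 2 * (2 * (2 * D)) ≡ 8 * D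
          eight = solve-∀
        -- Twice r, because the reservoir may take away r of these continuations.
        2r≤head : r + r ≤ ⟪ N a b W ⟫
        2r≤head = *-cancelˡ-≤ Hc (≤-trans (≤-reflexive (double Hc r)) (≤-trans r-Hc head))
          where
          double : ∀ h r → h * (r + r) ≡ 2 * h * r
          double = solve-∀
        reserve : (Σ (VSet n) λ R → (∀ v → R v ≡ true → N p q W v ≡ true) × ⟪ R ⟫ ≡ r) → HamiltonList
        reserve (R , R⊆ , ∣R∣) = close r k c R ∣R∣ (λ v Rv → proj₂ (N-elim p q W {v} (R⊆ v Rv))) good-q n≤cr c≤C ≤-refl
          (⟪ avail R L ⟫ ∸ r) s flat≡ P good-a
          (sym (m∸n+n≡m (≤-trans r≤N (card-mono _ _ λ v v∈ → proj₁ (N-elim a b (avail R L) {v} v∈)))))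
          (≤-trans r≤N (m≤n*m ⟪ N a b (avail R L) ⟫ (2 * D) {{m*n≢0 2 D}}))
          (λ v v∉ → not-F v (F-false v v∉)) (λ v v∉ → stock v (F-false v v∉))
          (λ v Rv → proj₂ (avail-elim F L v (proj₁ (N-elim p q W {v} (R⊆ v Rv)))))
          where
          F-false : ∀ v → occ v L ≡ 0 → F v ≡ false
          F-false v v∉ = go (F v) refl
            where
            go : ∀ β → F v ≡ β → F v ≡ false
            go false Fv = Fv
            go true  Fv = contradiction v∉ (covers v Fv)
          kept : ∀ v → N a b W v ≡ true → N a b (avail R L) v ≡ true ⊎ R v ≡ true
          kept v v∈ = go (R v) refl
            where
            go : ∀ β → R v ≡ β → N a b (avail R L) v ≡ true ⊎ R v ≡ true
            go true  Rv = inj₂ Rv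
            go false Rv =
              let Wv , abv = N-elim a b W {v} v∈
              in inj₁ (N-intro (avail R L) (avail-intro R L v Rv (proj₂ (avail-elim F L v Wv))) abv)
          r≤N : r ≤ ⟪ N a b (avail R L) ⟫
          r≤N = +-cancelʳ-≤ r r ⟪ N a b (avail R L) ⟫ (≤-trans 2r≤head
            (≤-trans (card-cover (N a b W) (N a b (avail R L)) R kept) (≤-reflexive (cong (⟪ N a b (avail R L) ⟫ +_) ∣R∣))))

      begin-insertion : Extension a₀ b₀ r₀ bad F (avail F L₀) → HamiltonList
      begin-insertion (extension x x∈ P₁ onward _) = close-up (insert-all k u f (pt x ∷ s₀) (cong (x ∷_) flat₀) P₁
        (not-bad x (proj₁ (avail-elim bad L₀ x x∈)))
        (≤-trans (chain 2 ⟪ avail F L₀ ⟫ _ n≤2W onward) (*-monoˡ-≤ _ 4D≤Hc))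
        (λ v Fv → <ᵇ-false (cnt v s₀) k (proj₂ (∨-false (bad v) (active s₀ v) Fv)))
        (card-mono (missing (x ∷ L₀)) F λ v v∈ → proj₁ (∧-true {F v} v∈))
        len₁ (≤-trans (*-monoˡ-≤ (f + u) 8A≤Q) Q-room) 2-room)

    hamilton-list : (∀ v → n * n ≤ A * degree v) → HamiltonList
    hamilton-list deg = finish deg stocked-path

  hamilton-list : (∀ v → n * n ≤ A * degree v) → HamiltonList
  hamilton-list deg = choose-q (card-witness G (pos 2 ⟪ G ⟫ n≤2G))
    where
    G : VSet n
    G = avail bad []
    n≤2G : n ≤ 2 * ⟪ G ⟫
    n≤2G = bad-half [] z≤n
    pos : ∀ c x → n ≤ c * x → 0 < x
    pos c (suc x) h = s≤s z≤n
    pos c zero    h = contradiction (≤-trans h (≤-reflexive (*-zeroʳ c))) (<⇒≱ (>-nonZero⁻¹ n))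
    bigG : Big G
    bigG = big-≤ G (≤-trans 2≤Hc Hc≤C) n≤2G
    good-G : ∀ {v} → G v ≡ true → Good D K v
    good-G {v} Gv = not-bad v (proj₁ (avail-elim bad [] v Gv))
    choose-p : ∀ q → G q ≡ true → (∃ λ p → G p ≡ true × ⟪ G ⟫ ≤ 2 * D * ⟪ N q p G ⟫ × ⟪ G ⟫ ≤ 2 * D * ⟪ N q p G ⟫) → HamiltonList
    choose-p q Gq (p , Gp , deg-p , _) = FromPair.hamilton-list p q (good-G Gp) (good-G Gq) p≢q tail deg
      where
      tail : n ≤ 2 * (2 * D) * ⟪ N q p G ⟫
      tail = ≤-trans n≤2G (≤-trans (*-monoʳ-≤ 2 deg-p) (≤-reflexive (sym (*-assoc 2 (2 * D) ⟪ N q p G ⟫))))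
      p≢q : p ≢ q
      p≢q = let w , w∈ = card-witness (N q p G) (pos (2 * (2 * D)) ⟪ N q p G ⟫ tail)
            in dist₁₂ H q p w (proj₂ (N-elim q p G {w} w∈)) ∘ sym
    choose-q : (∃ λ q → G q ≡ true) → HamiltonList
    choose-q (q , Gq) = choose-p q Gq (pick (good-G Gq) (good-G Gq) G G G bigG bigG bigG)

-- Constants and rational arithmetic

open import Data.Nat.Combinatorics using (_C_; nCk+nC[k+1]≡[n+1]C[k+1]; nC1≡n)
import Data.Integer as ℤ
import Data.Integer.Properties as ℤ
open import Data.Integer using (+_; -[1+_])
import Data.Rational.Unnormalised as ℚᵘ
import Data.Rational.Unnormalised.Properties as ℚᵘ
import Data.Rational as ℚ
import Data.Rational.Properties as ℚ
open import Data.Rational using (ℚ; mkℚ; 0ℚ; 1ℚ; toℚᵘ)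

-- Rounding n/E down costs at most a factor 2 once the quotient is positive.
quotient-bound : ∀ n E .{{_ : NonZero E}} → E ≤ n → n ≤ 2 * E * (n / E)
quotient-bound n E E≤n = begin
  n                                   ≡⟨ m≡m%n+[m/n]*n n E ⟩
  n % E + n / E * E                   ≤⟨ +-monoˡ-≤ (n / E * E) (<⇒≤ (m%n<n n E)) ⟩
  E + n / E * E                       ≤⟨ +-monoˡ-≤ (n / E * E) (m≤n*m E (n / E) {{>-nonZero (m≥n⇒m/n>0 E≤n)}}) ⟩
  n / E * E + n / E * E               ≡⟨ identity (n / E) E ⟩
  2 * E * (n / E)                     ∎
  where
  open ≤-Reasoning
  identity : ∀ r E → r * E + r * E ≡ 2 * E * r
  identity = solve-∀

-- At most n/Q vertices are spent before the greedy phase, n/Hc bounds from below the number of ways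
-- to continue the path until then, n/J the number of vertices caught by each gadget, n/E is the size of
-- the reservoir, and n/C bounds from below every set into which the path is ever extended.
module Constants (A D Q Hc J E C K R : ℕ) .{{_ : NonZero A}} .{{_ : NonZero D}}
  (Q≡ : Q ≡ 8 * A * D) (Hc≡ : Hc ≡ 2 * (2 * D) + 2 * (4 * A)) (J≡ : J ≡ 32 * Q * (2 * D) * (2 * D) * (2 * D))
  (E≡ : E ≡ 32 * Q * J + (2 * Hc + 8 * D)) (C≡ : C ≡ J + (2 * Hc + 2 * E * (2 * D)))
  (K≡ : K ≡ suc (4 * ((D * C) * (D * C)))) (R≡ : R ≡ K * D * (32 * Q)) where

  instance
    Hc≢0 : NonZero Hc
    Hc≢0 = >-nonZero (≤-trans (>-nonZero⁻¹ (2 * (2 * D)) {{m*n≢0 2 (2 * D) {{_}} {{m*n≢0 2 D}}}})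
      (≤-trans (m≤m+n _ _) (≤-reflexive (sym Hc≡))))
    E≢0 : NonZero E
    E≢0 = >-nonZero (≤-trans (>-nonZero⁻¹ (8 * D) {{m*n≢0 8 D}})
      (≤-trans (m≤n+m _ (2 * Hc)) (≤-trans (m≤n+m _ (32 * Q * J)) (≤-reflexive (sym E≡)))))

  -- Sums replace maxima: the summands of `E` give the upper bounds on r, those of `C` the lower
  -- bounds on `C`, and those of the threshold the lower bounds on `n`.
  tight-hamilton-cycle : ∀ n → E + (12 * Q + 2 * Hc * 7) ≤ n → (H : 3Graph n) →
    (∀ G₁ G₂ → R * |P₂| G₁ G₂ ≤ D * R * eH H G₁ G₂ + D * n ^ 3) → (∀ v → n * n ≤ A * Link.degree H v) → HasTightHamCycle H
  tight-hamilton-cycle zero n₀≤n = contradiction (≤-trans (m≤m+n E _) n₀≤n) (<⇒≱ (>-nonZero⁻¹ E))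
  tight-hamilton-cycle n@(suc _) n₀≤n H cherry deg = finish (hamilton-list deg)
    where
    open Link H using (module FewBad)
    open Absorption H using (HamiltonList)
    cherry′ : ∀ G₁ G₂ → K * D * (32 * Q) * |P₂| G₁ G₂ ≤ D * (K * D * (32 * Q)) * eH H G₁ G₂ + D * n ^ 3
    cherry′ G₁ G₂ = subst (λ R → R * |P₂| G₁ G₂ ≤ D * R * eH H G₁ G₂ + D * n ^ 3) R≡ (cherry G₁ G₂)
    open FewBad D K (32 * Q) cherry′ using (bad; bad-false⇒Good; few-bad)
    r : ℕ
    r = n / E
    Er≤n : E * r ≤ n
    Er≤n = ≤-trans (≤-reflexive (*-comm E r)) (m/n*n≤m n E)
    E≤n : E ≤ n
    E≤n = ≤-trans (m≤m+n E _) n₀≤n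
    below : ∀ x → x ≤ E → x * r ≤ n
    below x x≤E = ≤-trans (*-monoˡ-≤ r x≤E) Er≤n
    rest≤E : 2 * Hc + 8 * D ≤ E
    rest≤E = ≤-trans (m≤n+m _ (32 * Q * J)) (≤-reflexive (sym E≡))
    rest≤C : 2 * Hc + 2 * E * (2 * D) ≤ C
    rest≤C = ≤-trans (m≤n+m _ J) (≤-reflexive (sym C≡))
    rest≤n : 12 * Q + 2 * Hc * 7 ≤ n
    rest≤n = ≤-trans (m≤n+m _ E) n₀≤n
    open Assembly H A D Q Hc J C K r (2 * E)
      (≤-reflexive (sym K≡))
      (≤-trans (m≤m*n (8 * A) D) (≤-reflexive (sym Q≡)))
      (≤-trans (*-monoˡ-≤ D (m≤m*n 8 A)) (≤-reflexive (sym Q≡)))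
      (≤-trans (m≤m+n _ _) (≤-reflexive (sym Hc≡)))
      (≤-trans (m≤n+m _ (2 * (2 * D))) (≤-reflexive (sym Hc≡)))
      (≤-trans (m≤m+n _ _) rest≤C)
      J≡
      (≤-trans (m≤m+n _ _) (≤-reflexive (sym C≡)))
      (≤-trans (m≤n+m _ (2 * Hc)) rest≤C)
      (quotient-bound n E E≤n)
      (below (32 * Q * J) (≤-trans (m≤m+n _ _) (≤-reflexive (sym E≡))))
      (below (2 * Hc) (≤-trans (m≤m+n _ _) rest≤E))
      (below (8 * D) (≤-trans (m≤n+m _ (2 * Hc)) rest≤E))
      (≤-trans (m≤m+n _ _) rest≤n)
      (≤-trans (m≤n+m _ (12 * Q)) rest≤n)
      bad bad-false⇒Good few-bad
      using (hamilton-list)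
    finish : HamiltonList → HasTightHamCycle H
    finish (z , y , l , tight , once) = tight-cycle H z y l tight once

-- From rational hypotheses to integer inequalities

nC2-square : ∀ n → 2 * (n C 2) + n ≡ n * n
nC2-square zero    = refl
nC2-square (suc n) = trans (cong (λ q → 2 * q + suc n) (trans (sym (nCk+nC[k+1]≡[n+1]C[k+1] n 1)) (cong (_+ n C 2) (nC1≡n n))))
  (trans (regroup n (n C 2)) (trans (cong (λ q → q + (2 * n + 1)) (nC2-square n)) (square n)))
  where
  regroup : ∀ n x → 2 * (n + x) + suc n ≡ 2 * x + n + (2 * n + 1)
  regroup = solve-∀
  square : ∀ n → n * n + (2 * n + 1) ≡ suc n * suc n
  square = solve-∀

square≤4nC2 : ∀ n → 2 ≤ n → n * n ≤ 4 * (n C 2)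
square≤4nC2 n 2≤n = +-cancelʳ-≤ (n * n) _ _ (begin
  n * n + n * n                 ≡⟨ cong₂ _+_ (sym (nC2-square n)) (sym (nC2-square n)) ⟩
  2 * x + n + (2 * x + n)       ≡⟨ identity n x ⟩
  4 * x + 2 * n                 ≤⟨ +-monoʳ-≤ (4 * x) (*-monoˡ-≤ n 2≤n) ⟩
  4 * x + n * n                 ∎)
  where
  open ≤-Reasoning
  x : ℕ
  x = n C 2
  identity : ∀ n x → 2 * x + n + (2 * x + n) ≡ 4 * x + 2 * n
  identity = solve-∀

deg≤degree : ∀ {n} (H : 3Graph n) v → deg H v ≤ Link.degree H v
deg≤degree {n} H v = ≤-trans (≤-reflexive (trans (ΣV≡Σᵥ _) (Σ-cong λ x → ΣV≡Σᵥ _)))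
  (Σ-mono λ x → Σ-mono λ y → drop (toℕ x <ᵇ toℕ y) (edge H v x y))
  where
  drop : ∀ b c → 𝟙 (b ∧ c) ≤ 𝟙 c
  drop true  c = ≤-refl
  drop false c = z≤n

toℚᵘ-ℕtoℚ : ∀ k → toℚᵘ (ℕtoℚ k) ℚᵘ.≃ ℚᵘ.mkℚᵘ (+ k) 0
toℚᵘ-ℕtoℚ k = ℚ.toℚᵘ-fromℚᵘ (ℚᵘ.mkℚᵘ (+ k) 0)

-- A positive fraction is at least the reciprocal of its denominator, so the denominator alone can
-- serve as the constant.
min-degree-ℕ : ∀ (α : ℚ) → 0ℚ ℚ.< α → ∀ N e → α ℚ.* ℕtoℚ N ℚ.≤ ℕtoℚ e → N ≤ ℚ.↧ₙ α * e
min-degree-ℕ (mkℚ (+ zero)   b _) (ℚ.*<* (ℤ.+<+ ()))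
min-degree-ℕ (mkℚ -[1+ _ ]   b _) (ℚ.*<* ())
min-degree-ℕ α@(mkℚ (+ suc a) b _) _ N e h = ≤-trans (m≤n*m N (suc a)) (subst₂ _≤_ (lhs a N) (rhs b e)
  (ℤ.drop‿+≤+ (subst₂ ℤ._≤_ (trans (cong (ℤ._* + 1) (sym (ℤ.pos-* (suc a) N))) (sym (ℤ.pos-* (suc a * N) 1)))
    (sym (ℤ.pos-* e (suc b * 1))) (ℚᵘ.drop-*≤* hᵘ))))
  where
  hᵘ : ℚᵘ.mkℚᵘ (+ suc a) b ℚᵘ.* ℚᵘ.mkℚᵘ (+ N) 0 ℚᵘ.≤ ℚᵘ.mkℚᵘ (+ e) 0
  hᵘ = ℚᵘ.≤-respʳ-≃ (toℚᵘ-ℕtoℚ e) (ℚᵘ.≤-respˡ-≃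
    (ℚᵘ.≃-trans (ℚ.toℚᵘ-homo-* α (ℕtoℚ N)) (ℚᵘ.*-congˡ {toℚᵘ α} (toℚᵘ-ℕtoℚ N))) (ℚ.toℚᵘ-mono-≤ h))
  lhs : ∀ a N → suc a * N * 1 ≡ suc a * N
  lhs = solve-∀
  rhs : ∀ b e → e * (suc b * 1) ≡ suc b * e
  rhs = solve-∀

-- The error term is moved to the right, both denominators are cleared, and the numerator of `d`,
-- being at least 1, is dropped on the left.
cherry-ℕ : ∀ (d : ℚ) → 0ℚ ℚ.< d → ∀ R P e N → d ℚ.* ℕtoℚ P ℚ.- (+ 1 ℚ./ suc R) ℚ.* ℕtoℚ N ℚ.≤ ℕtoℚ e →
  suc R * P ≤ ℚ.↧ₙ d * suc R * e + ℚ.↧ₙ d * N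
cherry-ℕ (mkℚ (+ zero)   b _) (ℚ.*<* (ℤ.+<+ ()))
cherry-ℕ (mkℚ -[1+ _ ]   b _) (ℚ.*<* ())
cherry-ℕ d@(mkℚ (+ suc a) b _) _ R P e N h = ≤-trans (m≤n*m (suc R * P) (suc a)) (subst₂ _≤_ (lhs a P R) (rhs e R N b)
  (ℤ.drop‿+≤+ (subst₂ ℤ._≤_ posˡ posʳ (ℚᵘ.drop-*≤* hᵘ))))
  where
  ρ : ℚ
  ρ = + 1 ℚ./ suc R
  moved : d ℚ.* ℕtoℚ P ℚ.≤ ℕtoℚ e ℚ.+ ρ ℚ.* ℕtoℚ N
  moved = subst (ℚ._≤ ℕtoℚ e ℚ.+ ρ ℚ.* ℕtoℚ N) cancel (ℚ.+-monoˡ-≤ (ρ ℚ.* ℕtoℚ N) h)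
    where
    cancel : d ℚ.* ℕtoℚ P ℚ.- ρ ℚ.* ℕtoℚ N ℚ.+ ρ ℚ.* ℕtoℚ N ≡ d ℚ.* ℕtoℚ P
    cancel = trans (ℚ.+-assoc (d ℚ.* ℕtoℚ P) _ _)
      (trans (cong (λ q → d ℚ.* ℕtoℚ P ℚ.+ q) (ℚ.+-inverseˡ (ρ ℚ.* ℕtoℚ N))) (ℚ.+-identityʳ _))
  hᵘ : ℚᵘ.mkℚᵘ (+ suc a) b ℚᵘ.* ℚᵘ.mkℚᵘ (+ P) 0 ℚᵘ.≤ ℚᵘ.mkℚᵘ (+ e) 0 ℚᵘ.+ ℚᵘ.mkℚᵘ (+ 1) R ℚᵘ.* ℚᵘ.mkℚᵘ (+ N) 0
  hᵘ = ℚᵘ.≤-respʳ-≃ (ℚᵘ.≃-trans (ℚ.toℚᵘ-homo-+ (ℕtoℚ e) (ρ ℚ.* ℕtoℚ N)) (ℚᵘ.+-cong (toℚᵘ-ℕtoℚ e)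
      (ℚᵘ.≃-trans (ℚ.toℚᵘ-homo-* ρ (ℕtoℚ N)) (ℚᵘ.*-cong (ℚ.toℚᵘ-fromℚᵘ (ℚᵘ.mkℚᵘ (+ 1) R)) (toℚᵘ-ℕtoℚ N)))))
    (ℚᵘ.≤-respˡ-≃ (ℚᵘ.≃-trans (ℚ.toℚᵘ-homo-* d (ℕtoℚ P)) (ℚᵘ.*-congˡ {toℚᵘ d} (toℚᵘ-ℕtoℚ P))) (ℚ.toℚᵘ-mono-≤ moved))
  posˡ : (+ suc a ℤ.* + P) ℤ.* + (1 * (suc R * 1)) ≡ + (suc a * P * (1 * (suc R * 1)))
  posˡ = trans (cong (ℤ._* + (1 * (suc R * 1))) (sym (ℤ.pos-* (suc a) P))) (sym (ℤ.pos-* (suc a * P) _))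
  posʳ : (+ e ℤ.* + (suc R * 1) ℤ.+ (+ 1 ℤ.* + N) ℤ.* + 1) ℤ.* + (suc b * 1) ≡ + ((e * (suc R * 1) + 1 * N * 1) * (suc b * 1))
  posʳ = trans (cong (ℤ._* + (suc b * 1)) (trans (cong₂ ℤ._+_ (sym (ℤ.pos-* e (suc R * 1)))
      (trans (cong (ℤ._* + 1) (sym (ℤ.pos-* 1 N))) (sym (ℤ.pos-* (1 * N) 1)))) (sym (ℤ.pos-+ (e * (suc R * 1)) _))))
    (sym (ℤ.pos-* (e * (suc R * 1) + 1 * N * 1) (suc b * 1)))
  lhs : ∀ a P R → suc a * P * (1 * (suc R * 1)) ≡ suc a * (suc R * P)
  lhs = solve-∀
  rhs : ∀ e R N b → (e * (suc R * 1) + 1 * N * 1) * (suc b * 1) ≡ suc b * suc R * e + suc b * N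
  rhs = solve-∀

theorem1p2 : ∀ (α d : ℚ) → 0ℚ ℚ.< α → α ℚ.≤ 1ℚ → 0ℚ ℚ.< d → d ℚ.≤ 1ℚ →
    Σ ℕ λ n₀ → Σ ℚ λ ρ → 0ℚ ℚ.< ρ ×
    (∀ n → n ≥ n₀ → (H : 3Graph n) →
    CherryDense H ρ d → minDegAtLeast H α → HasTightHamCycle H)
-- Here ρ is 1/R, with `R` written as a successor to make the denominator visibly nonzero. The extra
-- 2 in the threshold serves `square≤4nC2`.
theorem1p2 α d 0<α _ 0<d _ = 2 + n₀ , + 1 ℚ./ suc (pred R) , ℚ.positive⁻¹ _ {{ℚ.normalize-pos 1 (suc (pred R))}} ,
  λ n n≥ H cherry min-deg → tight-hamilton-cycle n (≤-trans (m≤n+m n₀ 2) n≥) H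
    (λ G₁ G₂ → subst (λ q → q * |P₂| G₁ G₂ ≤ D * q * eH H G₁ G₂ + D * n ^ 3) (suc-pred R)
      (cherry-ℕ d 0<d (pred R) (|P₂| G₁ G₂) (eH H G₁ G₂) (n ^ 3) (cherry G₁ G₂)))
    (λ v → begin
      n * n                       ≤⟨ square≤4nC2 n (≤-trans (m≤m+n 2 n₀) n≥) ⟩
      4 * (n C 2)                 ≤⟨ *-monoʳ-≤ 4 (min-degree-ℕ α 0<α (n C 2) (deg H v) (min-deg v)) ⟩
      4 * (ℚ.↧ₙ α * deg H v)      ≡⟨ sym (*-assoc 4 (ℚ.↧ₙ α) (deg H v)) ⟩
      A * deg H v                 ≤⟨ *-monoʳ-≤ A (deg≤degree H v) ⟩
      A * Link.degree H v              ∎)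
  where
  open ≤-Reasoning
  A D Q Hc J E B K R n₀ : ℕ
  -- The factor 4 comes from n² ≤ 4·(n C 2).
  A = 4 * ℚ.↧ₙ α
  D = ℚ.↧ₙ d
  Q = 8 * A * D
  Hc = 2 * (2 * D) + 2 * (4 * A)
  J = 32 * Q * (2 * D) * (2 * D) * (2 * D)
  E = 32 * Q * J + (2 * Hc + 8 * D)
  -- This is the constant `C` of the modules above.
  B = J + (2 * Hc + 2 * E * (2 * D))
  K = suc (4 * ((D * B) * (D * B)))
  -- With ρ = 1/R at most n/32Q vertices are bad, as `used-bound` demands.
  R = K * D * (32 * Q)
  n₀ = E + (12 * Q + 2 * Hc * 7)
  instance
    Q≢0 : NonZero Q
    Q≢0 = m*n≢0 (8 * A) D
    R≢0 : NonZero R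
    R≢0 = m*n≢0 (K * D) (32 * Q) {{m*n≢0 K D}} {{m*n≢0 32 Q}}
  open Constants A D Q Hc J E B K R refl refl refl refl refl refl refl using (tight-hamilton-cycle)
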